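{- There is a universal constant $c>0$ such that for all integers $n,k\ge 1$, every function $f\colon\{0,1\}^n\to\{0,1\}$, every $\lambda\in(0,1]$, every $\lambda$-bounded product distribution $\mu$ over $\{0,1\}^n$, and every $\epsilon\ge 0$, $$\overline{\mathsf{D}}_{\epsilon}(f^k,\mu^k)\;\ge\; c\cdot k\lambda\cdot\overline{\mathsf{D}}_{\epsilon}(f,\mu).$$
   Context: Inner products are over $\mathbb{F}_2$: $\langle a,x\rangle=\sum_i a_ix_i \bmod 2$. A deterministic parity decision tree $T$ on $\{0,1\}^N$ is a rooted binary tree in which every internal node is labelled by a vector $a\in\{0,1\}^N$ (the query $\langle a,x\rangle$) and has two children, one for each outcome in $\{0,1\}$, and every leaf is labelled by an output value; $T(x)$ is the label of the leaf reached on input $x$, and $q(T,x)$ is the number of queries made by $T$ on $x$. A randomised parity decision tree $\mathcal{T}$ is a probability distribution over deterministic ones. For $g\colon\{0,1\}^N\to\{0,1\}^m$ and a probability distribution $\nu$ on $\{0,1\}^N$, let $\overline{q}(\mathcal{T},\nu)=\mathbb{E}_{T\sim\mathcal{T},x\sim\nu}[q(T,x)]$, $\mathrm{err}_g(\mathcal{T},\nu)=\Pr_{T\sim\mathcal{T},x\sim\nu}[T(x)\ne g(x)]$, and $\overline{\mathsf{D}}_\epsilon(g,\nu)=\min_{\mathcal{T}}\{\overline{q}(\mathcal{T},\nu):\mathrm{err}_g(\mathcal{T},\nu)\le\epsilon\}$. $f^k\colon(\{0,1\}^n)^k\to\{0,1\}^k$ is $f^k(x^1,\dots,x^k)=(f(x^1),\dots,f(x^k))$,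 and $\mu^k=\mu\times\cdots\times\mu$ ($k$ times). A distribution on $\{0,1\}^n$ is product if it is a product of $n$ independent Bernoulli distributions; a product distribution $\mu$ is $\lambda$-bounded, for $\lambda\in(0,1]$, if $\Pr_{x\sim\mu}[x_i=1]\in[\lambda/2,1-\lambda/2]$ for every $i\in[n]$. -}

module Defs where

open import Algebra.Apartness.Bundles using (HeytingField)
open import Algebra.Bundles using (CommutativeRing; Semiring)
import Algebra.Definitions.RawSemiring as RawSemiringDefs
open import Data.Bool.Base using (Bool; true; false; if_then_else_; _∧_; _xor_; not)
import Data.Bool.Properties as Bool
open import Data.Fin.Base using (Fin; toℕ)
open import Data.Nat.Base as ℕ using (ℕ; zero; suc)
open import Data.Product.Base using (∃-syntax; Σ-syntax; _×_; _,_; proj₁)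
open import Data.Sum.Base using (_⊎_)
open import Data.Vec.Base using (Vec; []; _∷_; lookup; map; foldr′; zipWith; group)
open import Data.Vec.Properties using (≡-dec)
open import Function.Base using (_∘_)
open import Level as Level using (_⊔_)
open import Relation.Binary.Core using (Rel)
open import Relation.Binary.Structures using (IsStrictPartialOrder)
open import Relation.Nullary.Decidable.Core using (does)
open import Relation.Nullary.Negation.Core using (¬_)

-- The real numbers, axiomatised as an Archimedean, Cauchy complete ordered
-- field.  The order is not assumed to be decidable, so that both the Cauchy
-- reals over ℚ and, classically, ℝ itself are models.

record Reals c ℓ₁ ℓ₂ : Set (Level.suc (c ⊔ ℓ₁ ⊔ ℓ₂)) where
  infix 4 _<_ _≤_

  field
    heytingField : HeytingField c ℓ₁ ℓ₂

  open HeytingField heytingField public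

  commutativeRing : CommutativeRing c ℓ₁
  commutativeRing = record { isCommutativeRing = isCommutativeRing }

  open RawSemiringDefs (Semiring.rawSemiring (CommutativeRing.semiring commutativeRing)) public
    using (sum; product)
    renaming (_×_ to infixr 8 _·_)

  field
    _<_                    : Rel Carrier ℓ₂
    <-isStrictPartialOrder : IsStrictPartialOrder _≈_ _<_
    <⇒#                    : ∀ {x y} → x < y → x # y
    #⇒<∨>                  : ∀ {x y} → x # y → x < y ⊎ y < x
    0<1                    : 0# < 1#
    +-monoˡ-<              : ∀ z {x y} → x < y → x + z < y + z
    0<x*y                  : ∀ {x y} → 0# < x → 0# < y → 0# < x * y

  _≤_ : Rel Carrier ℓ₂
  x ≤ y = ¬ (y < x)

  Cauchy : (ℕ → Carrier) → Set (c ⊔ ℓ₂)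
  Cauchy u = ∀ η → 0# < η →
    ∃[ M ] ∀ i j → M ℕ.≤ i → M ℕ.≤ j → u i - u j < η

  _⟶_ : (ℕ → Carrier) → Carrier → Set (c ⊔ ℓ₂)
  u ⟶ l = ∀ η → 0# < η →
    ∃[ M ] ∀ i → M ℕ.≤ i → (u i - l < η) × (l - u i < η)

  field
    archimedean : ∀ x → ∃[ m ] x < m · 1#
    complete    : ∀ u → Cauchy u → ∃[ l ] u ⟶ l

  HasSum : (ℕ → Carrier) → Carrier → Set (c ⊔ ℓ₂)
  HasSum u s = (λ m → sum {m} (u ∘ toℕ)) ⟶ s

  0<2 : 0# < 1# + 1#
  0<2 = <.trans 0<1 (<.<-respˡ-≈ (+-identityˡ 1#) (+-monoˡ-< 1# 0<1))
    where module < = IsStrictPartialOrder <-isStrictPartialOrder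

  ½ : Carrier
  ½ = proj₁ (#⇒invertible (#-sym (<⇒# 0<2)))

Input : ℕ → Set
Input = Vec Bool

⟨_,_⟩ : ∀ {N} → Vec Bool N → Input N → Bool
⟨ a , x ⟩ = foldr′ _xor_ false (zipWith _∧_ a x)

data PDT (N m : ℕ) : Set where
  leaf : (label : Vec Bool m) → PDT N m
  node : (a : Vec Bool N) (t₀ t₁ : PDT N m) → PDT N m

eval : ∀ {N m} → PDT N m → Input N → Vec Bool m
eval (leaf label)   x = label
eval (node a t₀ t₁) x = if ⟨ a , x ⟩ then eval t₁ x else eval t₀ x

queries : ∀ {N m} → PDT N m → Input N → ℕ
queries (leaf _)       x = 0
queries (node a t₀ t₁) x = suc (if ⟨ a , x ⟩ then queries t₁ x else queries t₀ x)

-- ({0,1}^n)^k is identified with {0,1}^{kn} by concatenating the k blocks.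

blocks : ∀ k {n} → Input (k ℕ.* n) → Vec (Input n) k
blocks k x = proj₁ (group k _ x)

power : ∀ k {n} → (Input n → Bool) → (Input (k ℕ.* n) → Vec Bool k)
power k f = map f ∘ blocks k

-- f itself, with its value read as an element of {0,1}^1.

single : ∀ {n} → (Input n → Bool) → (Input n → Vec Bool 1)
single f x = f x ∷ []

module Average {c ℓ₁ ℓ₂} (ℝ : Reals c ℓ₁ ℓ₂) where
  open Reals ℝ

  -- Distributions on {0,1}^N are given by their probability mass functions.

  Weight : ℕ → Set c
  Weight N = Input N → Carrier

  ∑ : ∀ {N} → (Input N → Carrier) → Carrier
  ∑ {zero}  F = F []
  ∑ {suc N} F = ∑ (F ∘ (false ∷_)) + ∑ (F ∘ (true ∷_))

  𝔼 : ∀ {N} → Weight N → (Input N → Carrier) → Carrier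
  𝔼 ν F = ∑ (λ x → ν x * F x)

  Pr : ∀ {N} → Weight N → (Input N → Bool) → Carrier
  Pr ν E = 𝔼 ν (λ x → if E x then 1# else 0#)

  IsDistribution : ∀ {N} → Weight N → Set (ℓ₁ ⊔ ℓ₂)
  IsDistribution ν = (∀ x → 0# ≤ ν x) × (∑ ν ≈ 1#)

  bernoulli : Carrier → Bool → Carrier
  bernoulli p b = if b then p else 1# - p

  IsProduct : ∀ {n} → Weight n → Set (c ⊔ ℓ₁ ⊔ ℓ₂)
  IsProduct {n} μ = Σ[ p ∈ (Fin n → Carrier) ]
    (∀ i → 0# ≤ p i × p i ≤ 1#) ×
    (∀ x → μ x ≈ product {n} (λ i → bernoulli (p i) (lookup x i)))

  IsBounded : ∀ {n} → Carrier → Weight n → Set ℓ₂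
  IsBounded {n} lam μ = ∀ (i : Fin n) →
    let pᵢ = Pr μ (λ x → lookup x i) in
    (lam * ½ ≤ pᵢ) × (pᵢ ≤ 1# - lam * ½)

  powerWeight : ∀ k {n} → Weight n → Weight (k ℕ.* n)
  powerWeight k μ x = product (λ j → μ (lookup (blocks k x) j))

  -- There are only countably many trees, so every probability distribution
  -- over them is given by a sequence of trees and their probabilities.
  -- Trees may repeat, and probabilities may vanish.

  record RandomisedPDT (N m : ℕ) : Set (c ⊔ ℓ₂) where
    field
      tree   : ℕ → PDT N m
      prob   : ℕ → Carrier
      0≤prob : ∀ i → 0# ≤ prob i
      total  : HasSum prob 1#

  open RandomisedPDT

  -- "q̄(𝒯,ν) = q"; a relation, since the expectation may be infinite.

  HasCost : ∀ {N m} → RandomisedPDT N m → Weight N → Carrier → Set (c ⊔ ℓ₂)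
  HasCost 𝒯 ν q =
    HasSum (λ i → prob 𝒯 i * 𝔼 ν (λ x → queries (tree 𝒯 i) x · 1#)) q

  errs : ∀ {N m} → (Input N → Vec Bool m) → PDT N m → Input N → Bool
  errs g T x = not (does (≡-dec Bool._≟_ (eval T x) (g x)))

  HasError : ∀ {N m} → (Input N → Vec Bool m) →
             RandomisedPDT N m → Weight N → Carrier → Set (c ⊔ ℓ₂)
  HasError g 𝒯 ν e = HasSum (λ i → prob 𝒯 i * Pr ν (errs g (tree 𝒯 i))) e

  ErrorAtMost : ∀ {N m} → Carrier → (Input N → Vec Bool m) →
                RandomisedPDT N m → Weight N → Set (c ⊔ ℓ₂)
  ErrorAtMost ε g 𝒯 ν = ∃[ e ] HasError g 𝒯 ν e × e ≤ ε

  -- "D̄_ε(g,ν) = d", that is, d is the minimum of the average costs.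

  record HasComplexity {N m} (ε : Carrier) (g : Input N → Vec Bool m)
                       (ν : Weight N) (d : Carrier) : Set (c ⊔ ℓ₂) where
    field
      attained   : ∃[ 𝒯 ] ErrorAtMost ε g 𝒯 ν × HasCost 𝒯 ν d
      lowerBound : ∀ 𝒯 q → ErrorAtMost ε g 𝒯 ν → HasCost 𝒯 ν q → d ≤ q

-- From a parity decision tree T for f^k we obtain a randomised tree for f by planting its input in
-- a random block and sampling the other blocks.  Since μ is λ-bounded, each sampled bit may be
-- drawn from a fair coin with probability λ, and such bits, called flagged, need not be fixed in
-- advance: whenever the answer to a query of T still depends on them, it is a coin toss, and only
-- queries that reduce to a parity of the planted block are charged.  Order the coordinates; in
-- echelon form, the charges to block i are at most the number of coordinates c in block i that lead
-- an element of the span of the queries of T vanishing on the flags of the other blocks and on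
-- block i before c.  This event does not depend on the flag of c itself, which is present with
-- probability at least λ/2 given the bit, and for every choice of flags the flagged leading
-- coordinates of all blocks number at most dim span ≤ q(T, x).  Hence the k blocks are charged at
-- most (2/λ) q(T, x) in total, and c = 1/2 works.

module Submission where

open import Defs
open import Algebra.Bundles using (CommutativeRing; CommutativeSemigroup)
import Algebra.Properties.CommutativeSemigroup as CommutativeSemigroupProperties
import Algebra.Properties.Group as GroupProperties
import Algebra.Properties.Ring as RingProperties
import Algebra.Properties.Semiring.Sum as SemiringSum
open import Data.Bool.Base using (Bool; true; false; if_then_else_; _∧_; _xor_; not; T)
import Data.Bool.Properties as Bool
open import Data.Fin.Base using (Fin; zero; suc; toℕ; fromℕ<; quotient; splitAt)
open import Data.Fin.Properties as Fin using (any?; all?; toℕ-fromℕ<; toℕ<n; toℕ-injective)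
open import Data.List.Base as List using (List; []; _∷_; length)
open import Data.List.Relation.Unary.All as All using (All; []; _∷_)
import Data.List.Relation.Unary.All.Properties as All
open import Data.Nat.Base as ℕ using (ℕ; zero; suc; z≤n; s≤s)
import Data.Nat.Properties as ℕ
open import Data.Product.Base as Product using (Σ; ∃; ∃-syntax; _×_; _,_; proj₁; proj₂; map₁)
open import Data.Sum.Base as Sum using (_⊎_; inj₁; inj₂)
open import Data.Unit.Base using (tt)
open import Data.Vec.Base as Vec using (Vec; []; _∷_; _++_; _[_]%=_; concat; drop; lookup; map; replicate; tabulate; take; zipWith)
open import Data.Vec.Properties using (≡-dec; ++-injective; drop-map; lookup-map; lookup-splitAt; lookup-zipWith; lookup∘tabulate; lookup∘updateAt′; map-++; take-map; take++drop≡id; zipWith-assoc; zipWith-comm)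
import Data.Vec.Relation.Unary.All as VecAll
import Data.Vec.Relation.Unary.All.Properties as VecAll
open import Function.Base using (_∘_; id; flip; case_of_)
open import Relation.Binary.Bundles using (Preorder)
open import Relation.Binary.PropositionalEquality as ≡ using (_≡_; _≢_)
import Relation.Binary.Reasoning.Preorder as PreorderReasoning
import Relation.Binary.Reasoning.Setoid as SetoidReasoning
open import Relation.Binary.Structures using (IsStrictPartialOrder)
open import Relation.Nullary.Decidable using (Dec; yes; no; does; dec-true; dec-false; _×-dec_; _⊎-dec_; _→-dec_)
open import Relation.Nullary.Negation using (¬_; contradiction)

open CommutativeSemigroupProperties (CommutativeRing.+-commutativeSemigroup Bool.xor-∧-commutativeRing)
  using () renaming (interchange to xor-interchange; xy∙z≈xz∙y to xor-right-comm; x∙yz≈y∙xz to xor-left-comm)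

-- A query mixes all blocks, so it has no owner, and the bounds on the charges for the `k` choices
-- of the planted block are ranks of `k` different spaces. For fixed flags they need not add up to
-- at most the number of queries: without any flags, one parity across two blocks is charged to
-- both. What does add up is the number of flagged leading coordinates, since on the flagged
-- coordinates alone all blocks see the same space. The passage to flagged coordinates is made on
-- average: the simulation of block `i` never consults the flags of block `i`, so they are still
-- fresh when its charges are counted, and the restriction costs a factor `λ / 2`, the weight of a
-- flagged symbol with a given bit.
--
-- The coin tosses are exact because an undetermined answer is flipped by a translation of the
-- flagged bits that preserves all earlier answers. The simulation is compared with the true run
-- through unnormalised masses, which avoids conditional probabilities. As expectations over a
-- sequence of trees may diverge, the cost of the extracted tree has to be proved to exist.

module LinearAlgebra where
  open ≡ using (refl; sym; trans; cong; cong₂; subst; isEquivalence; module ≡-Reasoning)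

  -- Parities over the field with two elements.

  infixl 6 _⊕_
  _⊕_ : ∀ {N} → Vec Bool N → Vec Bool N → Vec Bool N
  _⊕_ = zipWith _xor_

  ⊕-commutativeSemigroup : ℕ → CommutativeSemigroup _ _
  ⊕-commutativeSemigroup N = record
    { isCommutativeSemigroup = record
      { isSemigroup = record
        { isMagma = record { isEquivalence = isEquivalence ; ∙-cong = cong₂ (_⊕_ {N}) }
        ; assoc = zipWith-assoc Bool.xor-assoc }
      ; comm = zipWith-comm Bool.xor-comm } }

  ⊕-cancelʳ : ∀ {N} (a g : Vec Bool N) → a ⊕ g ⊕ g ≡ a
  ⊕-cancelʳ [] [] = refl
  ⊕-cancelʳ (a ∷ as) (g ∷ gs) = cong₂ _∷_
    (trans (Bool.xor-assoc a g g) (trans (cong (a xor_) (Bool.xor-same g)) (Bool.xor-identityʳ a)))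
    (⊕-cancelʳ as gs)

  lookup-⊕ : ∀ {N} (a b : Vec Bool N) c → lookup (a ⊕ b) c ≡ lookup a c xor lookup b c
  lookup-⊕ a b c = lookup-zipWith _xor_ c a b

  dot-⊕ˡ : ∀ {N} (a b x : Vec Bool N) → ⟨ a ⊕ b , x ⟩ ≡ ⟨ a , x ⟩ xor ⟨ b , x ⟩
  dot-⊕ˡ [] [] [] = refl
  dot-⊕ˡ (a ∷ as) (b ∷ bs) (x ∷ xs) =
    trans (cong₂ _xor_ (Bool.∧-distribʳ-xor x a b) (dot-⊕ˡ as bs xs))
          (xor-interchange (a ∧ x) (b ∧ x) _ _)

  dot-⊕ʳ : ∀ {N} (a x y : Vec Bool N) → ⟨ a , x ⊕ y ⟩ ≡ ⟨ a , x ⟩ xor ⟨ a , y ⟩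
  dot-⊕ʳ [] [] [] = refl
  dot-⊕ʳ (a ∷ as) (x ∷ xs) (y ∷ ys) =
    trans (cong₂ _xor_ (Bool.∧-distribˡ-xor a x y) (dot-⊕ʳ as xs ys))
          (xor-interchange (a ∧ x) (a ∧ y) _ _)

  dot-++ : ∀ {m n} (a x : Vec Bool m) (b y : Vec Bool n) → ⟨ a ++ b , x ++ y ⟩ ≡ ⟨ a , x ⟩ xor ⟨ b , y ⟩
  dot-++ [] [] b y = refl
  dot-++ (a ∷ as) (x ∷ xs) b y = trans (cong ((a ∧ x) xor_) (dot-++ as xs b y)) (sym (Bool.xor-assoc (a ∧ x) _ _))

  dot-agree : ∀ {N} (a x y : Vec Bool N) → (∀ c → lookup a c ≡ true → lookup x c ≡ lookup y c) →
              ⟨ a , x ⟩ ≡ ⟨ a , y ⟩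
  dot-agree [] [] [] agree = refl
  dot-agree (true ∷ as) (x ∷ xs) (y ∷ ys) agree = cong₂ _xor_ (agree zero refl) (dot-agree as xs ys (agree ∘ suc))
  dot-agree (false ∷ as) (x ∷ xs) (y ∷ ys) agree = dot-agree as xs ys (agree ∘ suc)

  dot-zeroʳ : ∀ {N} (a : Vec Bool N) → ⟨ a , replicate N false ⟩ ≡ false
  dot-zeroʳ [] = refl
  dot-zeroʳ (a ∷ as) = cong₂ _xor_ (Bool.∧-zeroʳ a) (dot-zeroʳ as)

  unit : ∀ {N} → Fin N → Vec Bool N
  unit zero    = true ∷ replicate _ false
  unit (suc c) = false ∷ unit c

  lookup-replicate-false : ∀ {N} (c : Fin N) → lookup (replicate N false) c ≡ false
  lookup-replicate-false zero = refl
  lookup-replicate-false (suc c) = lookup-replicate-false c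

  lookup-unit-≡ : ∀ {N} (c : Fin N) → lookup (unit c) c ≡ true
  lookup-unit-≡ zero = refl
  lookup-unit-≡ (suc c) = lookup-unit-≡ c

  lookup-unit-≢ : ∀ {N} (c c′ : Fin N) → c ≢ c′ → lookup (unit c) c′ ≡ false
  lookup-unit-≢ zero zero c≢c′ = contradiction refl c≢c′
  lookup-unit-≢ zero (suc c′) _ = lookup-replicate-false c′
  lookup-unit-≢ (suc c) zero _ = refl
  lookup-unit-≢ (suc c) (suc c′) c≢c′ = lookup-unit-≢ c c′ (c≢c′ ∘ cong suc)

  dot-unit : ∀ {N} (a : Vec Bool N) c → ⟨ a , unit c ⟩ ≡ lookup a c
  dot-unit (a ∷ as) zero = trans (cong₂ _xor_ (Bool.∧-identityʳ a) (dot-zeroʳ as)) (Bool.xor-identityʳ a)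
  dot-unit (a ∷ as) (suc c) = trans (cong (_xor ⟨ as , unit c ⟩) (Bool.∧-zeroʳ a)) (dot-unit as c)

  xor-transfer : ∀ x y β {g b} → x xor g ≡ β xor y → g ≡ b → x ≡ (β xor b) xor y
  xor-transfer x y β {g} p refl = begin
    x                  ≡⟨ Bool.xor-identityʳ x ⟨
    x xor false        ≡⟨ cong (x xor_) (Bool.xor-same g) ⟨
    x xor (g xor g)    ≡⟨ Bool.xor-assoc x g g ⟨
    (x xor g) xor g    ≡⟨ cong (_xor g) p ⟩
    (β xor y) xor g    ≡⟨ xor-right-comm β y g ⟩
    (β xor g) xor y    ∎
    where open ≡-Reasoning

  -- Linear constraints and their span on a region.

  Region : ℕ → Set
  Region N = Fin N → Bool

  Constraints : ℕ → Set
  Constraints N = List (Vec Bool N × Bool)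

  Satisfies : ∀ {N} → Constraints N → Input N → Set
  Satisfies V z = All (λ (g , b) → ⟨ g , z ⟩ ≡ b) V

  -- a agrees on U with an element of the span of the constraint vectors.
  InSpan : ∀ {N} → Constraints N → Region N → Vec Bool N → Set
  InSpan []            U a = ∀ c → U c ≡ true → lookup a c ≡ false
  InSpan ((g , _) ∷ V) U a = InSpan V U a ⊎ InSpan V U (a ⊕ g)

  inSpan? : ∀ {N} (V : Constraints N) U a → Dec (InSpan V U a)
  inSpan? []            U a = all? λ c → (U c Bool.≟ true) →-dec (lookup a c Bool.≟ false)
  inSpan? ((g , _) ∷ V) U a = inSpan? V U a ⊎-dec inSpan? V U (a ⊕ g)

  module _ {N : ℕ} where

    open CommutativeSemigroupProperties (⊕-commutativeSemigroup N)
      using () renaming (xy∙z≈xz∙y to ⊕-right-comm)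

    InSpan-resp : ∀ V {U U′ : Region N} {a a′} → (∀ c → U′ c ≡ true → U c ≡ true) →
                  (∀ c → U′ c ≡ true → lookup a c ≡ lookup a′ c) → InSpan V U a → InSpan V U′ a′
    InSpan-resp [] U′⊆U a≈a′ s c c∈U′ = trans (sym (a≈a′ c c∈U′)) (s c (U′⊆U c c∈U′))
    InSpan-resp ((g , _) ∷ V) U′⊆U a≈a′ (inj₁ s) = inj₁ (InSpan-resp V U′⊆U a≈a′ s)
    InSpan-resp ((g , _) ∷ V) {a = a} {a′} U′⊆U a≈a′ (inj₂ s) = inj₂ (InSpan-resp V U′⊆U
      (λ c c∈U′ → trans (lookup-⊕ a g c) (trans (cong (_xor lookup g c) (a≈a′ c c∈U′)) (sym (lookup-⊕ a′ g c)))) s)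

    InSpan-⊕ : ∀ V {U : Region N} {a b} → InSpan V U a → InSpan V U b → InSpan V U (a ⊕ b)
    InSpan-⊕ [] {a = a} {b} s t c c∈U = trans (lookup-⊕ a b c) (cong₂ _xor_ (s c c∈U) (t c c∈U))
    InSpan-⊕ ((g , _) ∷ V) (inj₁ s) (inj₁ t) = inj₁ (InSpan-⊕ V s t)
    InSpan-⊕ ((g , _) ∷ V) {U} {a} {b} (inj₁ s) (inj₂ t) =
      inj₂ (subst (InSpan V U) (sym (zipWith-assoc Bool.xor-assoc a b g)) (InSpan-⊕ V s t))
    InSpan-⊕ ((g , _) ∷ V) {U} {a} {b} (inj₂ s) (inj₁ t) =
      inj₂ (subst (InSpan V U) (⊕-right-comm a g b) (InSpan-⊕ V s t))
    InSpan-⊕ ((g , _) ∷ V) {U} {a} {b} (inj₂ s) (inj₂ t) =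
      inj₁ (subst (InSpan V U) cancel (InSpan-⊕ V s t))
      where
      cancel : a ⊕ g ⊕ (b ⊕ g) ≡ a ⊕ b
      cancel = trans (sym (zipWith-assoc Bool.xor-assoc (a ⊕ g) b g))
        (trans (cong (_⊕ g) (⊕-right-comm a g b)) (⊕-cancelʳ (a ⊕ b) g))

    -- The span element that agrees with `a` on `U` has one further bit to match, at `c`. If it does
    -- not match, flipping that bit of `a` repairs it.
    InSpan-extend : ∀ V {U U′ : Region N} {a} c → (∀ c′ → U′ c′ ≡ true → U c′ ≡ true ⊎ c′ ≡ c) →
                    InSpan V U a → InSpan V U′ a ⊎ InSpan V U′ (a ⊕ unit c)
    InSpan-extend [] {U} {U′} {a} c U′⊆U+c s with lookup a c in eq
    ... | false = inj₁ λ c′ c′∈U′ → case U′⊆U+c c′ c′∈U′ of λ where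
      (inj₁ c′∈U) → s c′ c′∈U
      (inj₂ refl) → eq
    ... | true = inj₂ λ c′ c′∈U′ → trans (lookup-⊕ a (unit c) c′) (case c Fin.≟ c′ of λ where
      (yes refl) → cong₂ _xor_ eq (lookup-unit-≡ c)
      (no c≢c′) → flip (cong₂ _xor_) (lookup-unit-≢ c c′ c≢c′) (case U′⊆U+c c′ c′∈U′ of λ where
        (inj₁ c′∈U) → s c′ c′∈U
        (inj₂ refl) → contradiction refl c≢c′))
    InSpan-extend ((g , _) ∷ V) c U′⊆U+c (inj₁ s) = Sum.map inj₁ inj₁ (InSpan-extend V c U′⊆U+c s)
    InSpan-extend ((g , _) ∷ V) {a = a} c U′⊆U+c (inj₂ s) = Sum.map inj₂
      (λ t → inj₂ (subst (InSpan V _) (⊕-right-comm a g (unit c)) t))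
      (InSpan-extend V c U′⊆U+c s)

    -- `v` is the sum of `a` and the span element that matches it on `U`, and `β` is the sum of the
    -- answers recorded for the constraints used. So the answer to `a` depends on coordinates
    -- outside `U` only.
    span⇒determined : ∀ V {U : Region N} {a} → InSpan V U a →
      ∃[ v ] ∃[ β ] (∀ c → U c ≡ true → lookup v c ≡ false) ×
                    (∀ z → Satisfies V z → ⟨ a , z ⟩ ≡ β xor ⟨ v , z ⟩)
    span⇒determined [] {a = a} s = a , false , s , λ _ _ → refl
    span⇒determined ((g , b) ∷ V) (inj₁ s) with v , β , v-off-U , det ← span⇒determined V s =
      v , β , v-off-U , λ { z (_ ∷ sat) → det z sat }
    span⇒determined ((g , b) ∷ V) {a = a} (inj₂ s) with v , β , v-off-U , det ← span⇒determined V s =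
      v , β xor b , v-off-U , λ { z (gz≡b ∷ sat) →
        xor-transfer ⟨ a , z ⟩ ⟨ v , z ⟩ β (trans (sym (dot-⊕ˡ a g z)) (det z sat)) gz≡b }

    -- A direction inside `U` along which every recorded answer stays the same and the answer to `a`
    -- flips.
    Separates : Constraints N → Region N → Vec Bool N → Vec Bool N → Set
    Separates V U a u = (∀ c → U c ≡ false → lookup u c ≡ false) ×
                        All (λ (g , _) → ⟨ g , u ⟩ ≡ false) V × ⟨ a , u ⟩ ≡ true

    -- Linear duality by induction on the constraints. Neither `a` nor `a ⊕ g` lies in the span of
    -- the rest, which yields `u` and `w`; one of `u`, `w` and `u ⊕ w` is orthogonal to `g` and
    -- still pairs to 1 with `a`.
    ¬span⇒separated : ∀ V {U : Region N} {a} → ¬ InSpan V U a → ∃ (Separates V U a)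
    ¬span⇒separated [] {U} {a} ¬s
      with any? (λ c → (U c Bool.≟ true) ×-dec (lookup a c Bool.≟ true))
    ... | yes (c , c∈U , ac) = unit c , off-U , [] , trans (dot-unit a c) ac
      where
      off-U : ∀ c′ → U c′ ≡ false → lookup (unit c) c′ ≡ false
      off-U c′ c′∉U = lookup-unit-≢ c c′ λ { refl → case trans (sym c∈U) c′∉U of λ () }
    ... | no ¬∃ = contradiction (λ c c∈U → Bool.¬-not λ ac → ¬∃ (c , c∈U , ac)) ¬s
    ¬span⇒separated ((g , b) ∷ V) {U} {a} ¬s
      with u , u-off-U , V⊥u , au ← ¬span⇒separated V (¬s ∘ inj₁)
      with ⟨ g , u ⟩ in gu
    ... | false = u , u-off-U , gu ∷ V⊥u , au
    ... | true
      with w , w-off-U , V⊥w , agw ← ¬span⇒separated V (¬s ∘ inj₂)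
      with ⟨ g , w ⟩ in gw
    ... | false = w , w-off-U , gw ∷ V⊥w , aw
      where
      aw : ⟨ a , w ⟩ ≡ true
      aw = trans (sym (Bool.xor-identityʳ _)) (trans (cong (⟨ a , w ⟩ xor_) (sym gw)) (trans (sym (dot-⊕ˡ a g w)) agw))
    ... | true = u ⊕ w , off-U , trans (dot-⊕ʳ g u w) (cong₂ _xor_ gu gw) ∷ ⊥-⊕ V V⊥u V⊥w ,
                 trans (dot-⊕ʳ a u w) (cong₂ _xor_ au aw)
      where
      off-U : ∀ c → U c ≡ false → lookup (u ⊕ w) c ≡ false
      off-U c c∉U = trans (lookup-⊕ u w c) (cong₂ _xor_ (u-off-U c c∉U) (w-off-U c c∉U))
      ⊥-⊕ : ∀ V → All (λ (g , _) → ⟨ g , u ⟩ ≡ false) V → All (λ (g , _) → ⟨ g , w ⟩ ≡ false) V →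
            All (λ (g , _) → ⟨ g , u ⊕ w ⟩ ≡ false) V
      ⊥-⊕ [] [] [] = []
      ⊥-⊕ ((g , _) ∷ V) (p ∷ ps) (q ∷ qs) = trans (dot-⊕ʳ g u w) (cong₂ _xor_ p q) ∷ ⊥-⊕ V ps qs
      aw : ⟨ a , w ⟩ ≡ false
      aw = Bool.not-injective {y = false} (trans (sym (Bool.xor-comm ⟨ a , w ⟩ true)) (trans (cong (⟨ a , w ⟩ xor_) (sym gw)) (trans (sym (dot-⊕ˡ a g w)) agw)))

  -- Counting coordinates.

  count : ∀ {N} → (Fin N → Bool) → ℕ
  count {zero}  f = 0
  count {suc N} f = (if f zero then 1 else 0) ℕ.+ count (f ∘ suc)

  count-none : ∀ {N} (f : Fin N → Bool) → (∀ c → f c ≢ true) → count f ≡ 0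
  count-none {zero} f none = refl
  count-none {suc N} f none with f zero in eq
  ... | true = contradiction eq (none zero)
  ... | false = count-none (f ∘ suc) (none ∘ suc)

  count-mono : ∀ {N} (f g : Fin N → Bool) → (∀ c → f c ≡ true → g c ≡ true) → count f ℕ.≤ count g
  count-mono {zero} f g f⊆g = z≤n
  count-mono {suc N} f g f⊆g with f zero | g zero | f⊆g zero
  ... | false | _     | _ = ℕ.≤-trans (count-mono (f ∘ suc) (g ∘ suc) (f⊆g ∘ suc)) (ℕ.m≤n+m _ _)
  ... | true  | true  | _ = s≤s (count-mono (f ∘ suc) (g ∘ suc) (f⊆g ∘ suc))
  ... | true  | false | p = case p refl of λ ()

  count-strict : ∀ {N} (f g : Fin N → Bool) → (∀ c → f c ≡ true → g c ≡ true) →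
                 ∀ c → f c ≡ false → g c ≡ true → count f ℕ.< count g
  count-strict f g f⊆g zero fc gc rewrite fc | gc = s≤s (count-mono (f ∘ suc) (g ∘ suc) (f⊆g ∘ suc))
  count-strict {suc N} f g f⊆g (suc c) fc gc with f zero | g zero | f⊆g zero | count-strict (f ∘ suc) (g ∘ suc) (f⊆g ∘ suc) c fc gc
  ... | false | _     | _ | l = ℕ.≤-trans l (ℕ.m≤n+m _ _)
  ... | true  | true  | _ | l = s≤s l
  ... | true  | false | p | l = case p refl of λ ()

  count-one-more : ∀ {N} (f g : Fin N → Bool) →
                   (∀ c c′ → f c ≡ false → g c ≡ true → f c′ ≡ false → g c′ ≡ true → c ≡ c′) →
                   count g ℕ.≤ suc (count f)
  count-one-more {zero} f g unique = z≤n
  count-one-more {suc N} f g unique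
    with f zero in fz | g zero in gz | count-one-more (f ∘ suc) (g ∘ suc) (λ c c′ p q r s → Fin.suc-injective (unique (suc c) (suc c′) p q r s))
  ... | true  | true  | l = s≤s l
  ... | true  | false | l = ℕ.m≤n⇒m≤1+n l
  ... | false | false | l = l
  ... | false | true  | _ = s≤s (count-mono (g ∘ suc) (f ∘ suc) g⊆f)
    where
    g⊆f : ∀ c → g (suc c) ≡ true → f (suc c) ≡ true
    g⊆f c gc with f (suc c) in fc
    ... | true = refl
    ... | false = case unique zero (suc c) fz gz fc gc of λ ()

  switch : ∀ {p} {P : ℕ → Set p} → (∀ t → Dec (P t)) → ∀ m → P 0 → ¬ P m → ∃[ t ] t ℕ.< m × P t × ¬ P (suc t)
  switch P? zero p0 ¬p = contradiction p0 ¬p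
  switch P? (suc m) p0 ¬p with P? m
  ... | yes pm = m , ℕ.≤-refl , pm , ¬p
  ... | no ¬pm with t , t<m , q ← switch P? m p0 ¬pm = t , ℕ.m≤n⇒m≤1+n t<m , q

  <ᵇ⇒< : ∀ {m n} → (m ℕ.<ᵇ n) ≡ true → m ℕ.< n
  <ᵇ⇒< {m} {n} eq = ℕ.<ᵇ⇒< m n (subst T (sym eq) _)

  <⇒<ᵇ : ∀ {m n} → m ℕ.< n → (m ℕ.<ᵇ n) ≡ true
  <⇒<ᵇ {m} {n} m<n with m ℕ.<ᵇ n | ℕ.<⇒<ᵇ m<n
  ... | true | _ = refl

  ∧-true : ∀ {x y} → x ∧ y ≡ true → x ≡ true × y ≡ true
  ∧-true {true} {true} _ = refl , refl

  does-true : ∀ {p} {P : Set p} (P? : Dec P) → does P? ≡ true → P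
  does-true (yes p) _ = p

  does-false : ∀ {p} {P : Set p} (P? : Dec P) → does P? ≡ false → ¬ P
  does-false (no ¬p) _ = ¬p

  -- Leading coordinates and the charges of a block.

  module Pivots {N k : ℕ} (colour : Fin N → Fin k) where

    open CommutativeSemigroupProperties (⊕-commutativeSemigroup N)
      using () renaming (xy∙z≈xz∙y to ⊕-right-comm)

    -- The coordinates that count as unknown. At `t = 0` class `i` is known and at `t = N` it is
    -- wholly unknown; moving `t` from one to the other locates a leading coordinate.
    region : Fin k → ℕ → Region N → Region N
    region i t S c = if does (colour c Fin.≟ i) then toℕ c ℕ.<ᵇ t else S c

    -- Some element of the span of V is 1 at c, and vanishes on S outside the colour class of c and on
    -- the members of that class before c.
    Lead : Constraints N → Region N → Fin N → Set
    Lead V S c = InSpan V (region (colour c) (suc (toℕ c)) S) (unit c)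

    lead? : ∀ V S c → Dec (Lead V S c)
    lead? V S c = inSpan? V (region (colour c) (suc (toℕ c)) S) (unit c)

    -- Given the earlier answers and the coordinates outside S, the query a amounts to one new parity
    -- of the coordinates of colour i.
    charged : Region N → Fin k → Constraints N → Vec Bool N → Bool
    charged S i V a = not (does (inSpan? V (region i N S) a)) ∧ does (inSpan? V (region i 0 S) a)

    region-suc : ∀ i t S c → region i (suc t) S c ≡ true → region i t S c ≡ true ⊎ toℕ c ≡ t
    region-suc i t S c p with does (colour c Fin.≟ i)
    ... | false = inj₁ p
    ... | true with ℕ.m≤n⇒m<n∨m≡n (ℕ.s≤s⁻¹ (<ᵇ⇒< p))
    ...   | inj₁ c<t = inj₁ (<⇒<ᵇ c<t)
    ...   | inj₂ c≡t = inj₂ c≡t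

    -- Let `t` run from 0 to `N` until `a` drops out of the span. The coordinate `c` at position `t`
    -- belongs to class `i`, as the region would not change otherwise. The matching element differs
    -- from `a` at `c`, so adding the constraint `a` puts `unit c` into the span; had it been there
    -- before, `a` would not have dropped out.
    charged⇒lead : ∀ S i V a b → InSpan V (region i 0 S) a → ¬ InSpan V (region i N S) a →
                   ∃[ c ] colour c ≡ i × Lead ((a , b) ∷ V) S c × ¬ Lead V S c
    charged⇒lead S i V a b s ¬s
      with t , t<N , st , ¬st ← switch {P = λ t → InSpan V (region i t S) a} (λ t → inSpan? V (region i t S) a) N s ¬s
      = c , colour-c , inj₂ (subst (InSpan V _) (zipWith-comm Bool.xor-comm a (unit c)) lead) , ¬lead
      where
      c = fromℕ< t<N
      toℕ-c : toℕ c ≡ t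
      toℕ-c = toℕ-fromℕ< t<N
      colour-c : colour c ≡ i
      colour-c with colour c Fin.≟ i
      ... | yes eq = eq
      ... | no neq = contradiction (InSpan-resp V sub (λ _ _ → refl) st) ¬st
        where
        sub : ∀ c′ → region i (suc t) S c′ ≡ true → region i t S c′ ≡ true
        sub c′ p with region-suc i t S c′ p
        ... | inj₁ q = q
        ... | inj₂ c′≡t with refl ← toℕ-injective {i = c′} {c} (trans c′≡t (sym toℕ-c)) with colour c Fin.≟ i
        ...   | yes eq = contradiction eq neq
        ...   | no _ = p
      reg : region (colour c) (suc (toℕ c)) S ≡ region i (suc t) S
      reg = cong₂ (λ j t → region j (suc t) S) colour-c toℕ-c
      lead : InSpan V (region (colour c) (suc (toℕ c)) S) (a ⊕ unit c)
      lead with InSpan-extend V {U′ = region i (suc t) S} c (λ c′ p → Sum.map₂ (λ q → toℕ-injective (trans q (sym toℕ-c))) (region-suc i t S c′ p)) st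
      ... | inj₁ q = contradiction q ¬st
      ... | inj₂ q = subst (λ U → InSpan V U (a ⊕ unit c)) (sym reg) q
      ¬lead : ¬ Lead V S c
      ¬lead l = ¬st (subst (λ U → InSpan V U a) reg
        (subst (InSpan V _) (⊕-cancelʳ a (unit c)) (InSpan-⊕ V lead l)))

    leads : Constraints N → Region N → Fin k → Fin N → Bool
    leads V S i c = does (colour c Fin.≟ i) ∧ does (lead? V S c)

    leads-∷ : ∀ S i V a b c → leads V S i c ≡ true → leads ((a , b) ∷ V) S i c ≡ true
    leads-∷ S i V a b c p with does (colour c Fin.≟ i) | lead? V S c
    ... | true | yes l = refl

    -- The number of leading coordinates of class `i` serves as a potential: it never falls, and
    -- every charge raises it.
    count-leads-∷ : ∀ S i V a b →
      (if charged S i V a then 1 else 0) ℕ.+ count (leads V S i) ℕ.≤ count (leads ((a , b) ∷ V) S i)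
    count-leads-∷ S i V a b with inSpan? V (region i N S) a | inSpan? V (region i 0 S) a
    ... | yes _ | _     = count-mono (leads V S i) _ (leads-∷ S i V a b)
    ... | no _  | no _  = count-mono (leads V S i) _ (leads-∷ S i V a b)
    ... | no ¬s | yes s with c , refl , l , ¬l ← charged⇒lead S i V a b s ¬s =
      count-strict (leads V S i) _ (leads-∷ S i V a b) c
        (trans (cong (does (colour c Fin.≟ colour c) ∧_) (dec-false (lead? V S c) ¬l)) (Bool.∧-zeroʳ _))
        (cong₂ _∧_ (dec-true (colour c Fin.≟ colour c) refl) (dec-true (lead? ((a , b) ∷ V) S c) l))
    -- The classes are forgotten here: these are the leading positions of one space, the span
    -- restricted to `S`, so that a dimension count applies. It relaxes `Lead`, whose regions differ
    -- from class to class.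
    Lead≤ : Constraints N → Region N → Fin N → Set
    Lead≤ V S c = InSpan V (λ c′ → S c′ ∧ (toℕ c′ ℕ.<ᵇ suc (toℕ c))) (unit c)

    lead≤? : ∀ V S c → Dec (Lead≤ V S c)
    lead≤? V S c = inSpan? V (λ c′ → S c′ ∧ (toℕ c′ ℕ.<ᵇ suc (toℕ c))) (unit c)

    -- One more constraint creates at most one new leading position: the sum of two would lead at the
    -- smaller one without it.
    count-lead≤ : ∀ S V → count (λ c → S c ∧ does (lead≤? V S c)) ℕ.≤ length V
    count-lead≤ S [] = ℕ.≤-reflexive (count-none _ none)
      where
      none : ∀ c → S c ∧ does (lead≤? [] S c) ≢ true
      none c eq with c∈S , l ← ∧-true eq
        with () ← trans (sym (lookup-unit-≡ c))
                    (does-true (lead≤? [] S c) l c (cong₂ _∧_ c∈S (<⇒<ᵇ (ℕ.n<1+n (toℕ c)))))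
    count-lead≤ S ((g , b) ∷ V) = ℕ.≤-trans
      (count-one-more (λ c → S c ∧ does (lead≤? V S c)) _ unique) (s≤s (count-lead≤ S V))
      where
      New : Fin N → Set
      New c = S c ≡ true × ¬ Lead≤ V S c × InSpan V (λ c′ → S c′ ∧ (toℕ c′ ℕ.<ᵇ suc (toℕ c))) (unit c ⊕ g)
      new : ∀ c → (S c ∧ does (lead≤? V S c)) ≡ false → (S c ∧ does (lead≤? ((g , b) ∷ V) S c)) ≡ true → New c
      new c p q with c∈S , l ← ∧-true {S c} q = c∈S , ¬l , pick (does-true (lead≤? ((g , b) ∷ V) S c) l)
        where
        ¬l : ¬ Lead≤ V S c
        ¬l = does-false (lead≤? V S c) (trans (sym (cong (_∧ does (lead≤? V S c)) c∈S)) p)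
        pick : Lead≤ ((g , b) ∷ V) S c → InSpan V (λ c′ → S c′ ∧ (toℕ c′ ℕ.<ᵇ suc (toℕ c))) (unit c ⊕ g)
        pick (inj₁ l) = contradiction l ¬l
        pick (inj₂ l) = l
      ¬< : ∀ c c′ → New c → New c′ → ¬ (toℕ c ℕ.< toℕ c′)
      ¬< c c′ (c∈S , ¬l , s) (_ , _ , s′) c<c′ = ¬l (InSpan-resp V (λ _ → id) agree
        (InSpan-⊕ V s (InSpan-resp V sub (λ _ _ → refl) s′)))
        where
        sub : ∀ d → S d ∧ (toℕ d ℕ.<ᵇ suc (toℕ c)) ≡ true → S d ∧ (toℕ d ℕ.<ᵇ suc (toℕ c′)) ≡ true
        sub d p with S d
        ... | true = <⇒<ᵇ (ℕ.<-≤-trans (<ᵇ⇒< {toℕ d} p) (s≤s (ℕ.<⇒≤ c<c′)))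
        cancel : (unit c ⊕ g) ⊕ (unit c′ ⊕ g) ≡ unit c ⊕ unit c′
        cancel = trans (sym (zipWith-assoc Bool.xor-assoc (unit c ⊕ g) (unit c′) g))
          (trans (cong (_⊕ g) (⊕-right-comm (unit c) g (unit c′))) (⊕-cancelʳ (unit c ⊕ unit c′) g))
        agree : ∀ d → S d ∧ (toℕ d ℕ.<ᵇ suc (toℕ c)) ≡ true →
                lookup ((unit c ⊕ g) ⊕ (unit c′ ⊕ g)) d ≡ lookup (unit c) d
        agree d p = begin
          lookup ((unit c ⊕ g) ⊕ (unit c′ ⊕ g)) d ≡⟨ cong (λ v → lookup v d) cancel ⟩
          lookup (unit c ⊕ unit c′) d ≡⟨ lookup-⊕ (unit c) (unit c′) d ⟩
          lookup (unit c) d xor lookup (unit c′) d ≡⟨ cong (lookup (unit c) d xor_) (lookup-unit-≢ c′ d c′≢d) ⟩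
          lookup (unit c) d xor false ≡⟨ Bool.xor-identityʳ _ ⟩
          lookup (unit c) d ∎
          where
          open ≡-Reasoning
          c′≢d : c′ ≢ d
          c′≢d refl with S c′
          ... | true = ℕ.<⇒≱ c<c′ (ℕ.s≤s⁻¹ (<ᵇ⇒< {toℕ c′} p))
      unique : ∀ c c′ → _ → _ → _ → _ → c ≡ c′
      unique c c′ p q p′ q′ = toℕ-injective (ℕ.≤-antisym
        (ℕ.≮⇒≥ (¬< c′ c (new c′ p′ q′) (new c p q))) (ℕ.≮⇒≥ (¬< c c′ (new c p q) (new c′ p′ q′))))

    lead⇒lead≤ : ∀ V S c → Lead V S c → Lead≤ V S c
    lead⇒lead≤ V S c = InSpan-resp V sub (λ _ _ → refl)
      where
      sub : ∀ d → S d ∧ (toℕ d ℕ.<ᵇ suc (toℕ c)) ≡ true → region (colour c) (suc (toℕ c)) S d ≡ true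
      sub d p with S d | does (colour d Fin.≟ colour c)
      ... | true | true = p
      ... | true | false = refl

    count-lead : ∀ S V → count (λ c → S c ∧ does (lead? V S c)) ℕ.≤ length V
    count-lead S V = ℕ.≤-trans (count-mono _ _ relax) (count-lead≤ S V)
      where
      relax : ∀ c → S c ∧ does (lead? V S c) ≡ true → S c ∧ does (lead≤? V S c) ≡ true
      relax c p with S c | lead? V S c
      ... | true | yes l = dec-true (lead≤? V S c) (lead⇒lead≤ V S c l)

    lead-resp : ∀ V S S′ c → (∀ c′ → colour c′ ≢ colour c → S c′ ≡ S′ c′) → Lead V S c → Lead V S′ c
    lead-resp V S S′ c same = InSpan-resp V sub (λ _ _ → refl)
      where
      sub : ∀ c′ → region (colour c) (suc (toℕ c)) S′ c′ ≡ true → region (colour c) (suc (toℕ c)) S c′ ≡ true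
      sub c′ p with colour c′ Fin.≟ colour c
      ... | yes _ = p
      ... | no neq = trans (same c′ neq) p

    -- The region of `c` consults `S` only outside the class of `c`. Hence, for a given transcript,
    -- the flags of a block, that of `c` included, have no influence on which of its coordinates
    -- lead.
    lead-local : ∀ V S S′ c → (∀ c′ → colour c′ ≢ colour c → S c′ ≡ S′ c′) →
                 does (lead? V S c) ≡ does (lead? V S′ c)
    lead-local V S S′ c same with lead? V S c
    ... | yes l = sym (dec-true (lead? V S′ c) (lead-resp V S S′ c same l))
    ... | no ¬l = sym (dec-false (lead? V S′ c) (¬l ∘ lead-resp V S′ S c (λ c′ neq → sym (same c′ neq))))

    transcript : ∀ {m} → Constraints N → PDT N m → Input N → Constraints N
    transcript V (leaf _) z = V
    transcript V (node a t₀ t₁) z = if ⟨ a , z ⟩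
      then transcript ((a , true) ∷ V) t₁ z else transcript ((a , false) ∷ V) t₀ z

    length-transcript : ∀ {m} V (t : PDT N m) z → length (transcript V t z) ≡ queries t z ℕ.+ length V
    length-transcript V (leaf _) z = refl
    length-transcript V (node a t₀ t₁) z with ⟨ a , z ⟩
    ... | true = trans (length-transcript _ t₁ z) (ℕ.+-suc _ _)
    ... | false = trans (length-transcript _ t₀ z) (ℕ.+-suc _ _)

    charges : ∀ {m} → Region N → Fin k → Constraints N → PDT N m → Input N → ℕ
    charges S i V (leaf _) z = 0
    charges S i V (node a t₀ t₁) z = (if charged S i V a then 1 else 0) ℕ.+
      (if ⟨ a , z ⟩ then charges S i ((a , true) ∷ V) t₁ z else charges S i ((a , false) ∷ V) t₀ z)

    charges-leads : ∀ {m} S i V (t : PDT N m) z →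
      charges S i V t z ℕ.+ count (leads V S i) ℕ.≤ count (leads (transcript V t z) S i)
    charges-leads S i V (leaf _) z = ℕ.≤-refl
    charges-leads S i V (node a t₀ t₁) z = by-answer ⟨ a , z ⟩
      where
      step : ∀ p {q r s u} → q ℕ.+ s ℕ.≤ u → p ℕ.+ r ℕ.≤ s → p ℕ.+ q ℕ.+ r ℕ.≤ u
      step p {q} {r} l m = ℕ.≤-trans (ℕ.≤-reflexive (trans (cong (ℕ._+ r) (ℕ.+-comm p q)) (ℕ.+-assoc q p r)))
        (ℕ.≤-trans (ℕ.+-monoʳ-≤ q m) l)
      charge = if charged S i V a then 1 else 0
      by-answer : ∀ b →
        charge ℕ.+
        (if b then charges S i ((a , true) ∷ V) t₁ z else charges S i ((a , false) ∷ V) t₀ z) ℕ.+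
        count (leads V S i) ℕ.≤
        count (leads (if b then transcript ((a , true) ∷ V) t₁ z else transcript ((a , false) ∷ V) t₀ z) S i)
      by-answer true  = step charge (charges-leads S i ((a , true) ∷ V) t₁ z) (count-leads-∷ S i V a true)
      by-answer false = step charge (charges-leads S i ((a , false) ∷ V) t₀ z) (count-leads-∷ S i V a false)

open LinearAlgebra

-- Ordered-field arithmetic without a decidable order.

module RealProperties {c ℓ₁ ℓ₂} (ℝ : Reals c ℓ₁ ℓ₂) where
  open Reals ℝ public hiding (zero)
  open CommutativeRing commutativeRing public using (ring; semiring; +-group; *-commutativeSemigroup; +-commutativeSemigroup)
  open RingProperties ring public using (-‿distribʳ-*; -0#≈0#)
  open SemiringSum semiring public using (sum-cong-≋; ∑-distrib-+; *-distribˡ-sum; ∑-comm)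
  open CommutativeSemigroupProperties +-commutativeSemigroup public using ()
    renaming (interchange to +-interchange; x∙yz≈y∙xz to x+[y+z]≈y+[x+z])
  open CommutativeSemigroupProperties *-commutativeSemigroup public using ()
    renaming (x∙yz≈y∙xz to x*[y*z]≈y*[x*z])

  module < = IsStrictPartialOrder <-isStrictPartialOrder

  <-cotrans : ∀ {x y} → x < y → ∀ z → x < z ⊎ z < y
  <-cotrans x<y z with #-cotrans (<⇒# x<y) z
  ... | inj₁ x#z = Sum.map₂ (λ z<x → <.trans z<x x<y) (#⇒<∨> x#z)
  ... | inj₂ z#y = Sum.swap (Sum.map₂ (<.trans x<y) (#⇒<∨> z#y))

  ≤-refl : ∀ {x} → x ≤ x
  ≤-refl = <.irrefl refl

  ≤-reflexive : ∀ {x y} → x ≈ y → x ≤ y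
  ≤-reflexive x≈y = <.irrefl (sym x≈y)

  ≤-trans : ∀ {x y z} → x ≤ y → y ≤ z → x ≤ z
  ≤-trans {y = y} x≤y y≤z z<x with <-cotrans z<x y
  ... | inj₁ z<y = y≤z z<y
  ... | inj₂ y<x = x≤y y<x

  <⇒≤ : ∀ {x y} → x < y → x ≤ y
  <⇒≤ = <.asym

  ≤-<-trans : ∀ {x y z} → x ≤ y → y < z → x < z
  ≤-<-trans {x} x≤y y<z with <-cotrans y<z x
  ... | inj₁ y<x = contradiction y<x x≤y
  ... | inj₂ x<z = x<z

  <-≤-trans : ∀ {x y z} → x < y → y ≤ z → x < z
  <-≤-trans {z = z} x<y y≤z with <-cotrans x<y z
  ... | inj₁ x<z = x<z
  ... | inj₂ z<y = contradiction z<y y≤z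

  <-resp-≈ : ∀ {x x′ y y′} → x ≈ x′ → y ≈ y′ → x < y → x′ < y′
  <-resp-≈ x≈x′ y≈y′ x<y = <.<-respˡ-≈ x≈x′ (<.<-respʳ-≈ y≈y′ x<y)

  ≤-resp-≈ : ∀ {x x′ y y′} → x ≈ x′ → y ≈ y′ → x ≤ y → x′ ≤ y′
  ≤-resp-≈ x≈x′ y≈y′ x≤y y′<x′ = x≤y (<-resp-≈ (sym y≈y′) (sym x≈x′) y′<x′)

  ≤-preorder : Preorder _ _ _
  ≤-preorder = record
    { _≈_ = _≈_ ; _≲_ = _≤_
    ; isPreorder = record { isEquivalence = isEquivalence ; reflexive = ≤-reflexive ; trans = ≤-trans } }

  module ≈-Reasoning = SetoidReasoning (CommutativeRing.setoid commutativeRing)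
  module ≤-Reasoning = PreorderReasoning ≤-preorder

  x-y+y≈x : ∀ x y → (x - y) + y ≈ x
  x-y+y≈x = λ x y → GroupProperties.//-rightDividesˡ +-group y x

  x+y-y≈x : ∀ x y → (x + y) - y ≈ x
  x+y-y≈x x y = GroupProperties.//-rightDividesʳ +-group y x

  +-cancelʳ-< : ∀ z {x y} → x + z < y + z → x < y
  +-cancelʳ-< z x+z<y+z = <-resp-≈ (x+y-y≈x _ z) (x+y-y≈x _ z) (+-monoˡ-< (- z) x+z<y+z)

  +-monoˡ-≤ : ∀ z {x y} → x ≤ y → x + z ≤ y + z
  +-monoˡ-≤ z x≤y = x≤y ∘ +-cancelʳ-< z

  +-monoʳ-≤ : ∀ z {x y} → x ≤ y → z + x ≤ z + y
  +-monoʳ-≤ z x≤y = ≤-resp-≈ (+-comm _ z) (+-comm _ z) (+-monoˡ-≤ z x≤y)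

  +-mono-≤ : ∀ {x y u v} → x ≤ y → u ≤ v → x + u ≤ y + v
  +-mono-≤ x≤y u≤v = ≤-trans (+-monoˡ-≤ _ x≤y) (+-monoʳ-≤ _ u≤v)

  0≤x+y : ∀ {x y} → 0# ≤ x → 0# ≤ y → 0# ≤ x + y
  0≤x+y 0≤x 0≤y = ≤-resp-≈ (+-identityˡ 0#) refl (+-mono-≤ 0≤x 0≤y)

  x≤x+y : ∀ {x y} → 0# ≤ y → x ≤ x + y
  x≤x+y 0≤y = ≤-resp-≈ (+-identityʳ _) refl (+-monoʳ-≤ _ 0≤y)

  y≤x+y : ∀ {x y} → 0# ≤ x → y ≤ x + y
  y≤x+y 0≤x = ≤-resp-≈ (+-identityˡ _) refl (+-monoˡ-≤ _ 0≤x)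

  x≤y⇒0≤y-x : ∀ {x y} → x ≤ y → 0# ≤ y - x
  x≤y⇒0≤y-x {x} x≤y = ≤-resp-≈ (-‿inverseʳ x) refl (+-monoˡ-≤ (- x) x≤y)

  0≤y-x⇒x≤y : ∀ {x y} → 0# ≤ y - x → x ≤ y
  0≤y-x⇒x≤y {x} {y} 0≤y-x = ≤-resp-≈ (+-identityˡ x) (x-y+y≈x y x) (+-monoˡ-≤ x 0≤y-x)

  x<y⇒0<y-x : ∀ {x y} → x < y → 0# < y - x
  x<y⇒0<y-x {x} x<y = <-resp-≈ (-‿inverseʳ x) refl (+-monoˡ-< (- x) x<y)

  0<y-x⇒x<y : ∀ {x y} → 0# < y - x → x < y
  0<y-x⇒x<y {x} {y} 0<y-x = <-resp-≈ (+-identityˡ x) (x-y+y≈x y x) (+-monoˡ-< x 0<y-x)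

  x-y<z⇒x<z+y : ∀ {x y z} → x - y < z → x < z + y
  x-y<z⇒x<z+y {x} {y} l = <-resp-≈ (x-y+y≈x x y) refl (+-monoˡ-< y l)

  x<z+y⇒x-y<z : ∀ {x y z} → x < z + y → x - y < z
  x<z+y⇒x-y<z {x} {y} {z} l = <-resp-≈ refl (x+y-y≈x z y) (+-monoˡ-< (- y) l)

  -‿cancelˡ-< : ∀ {x y z} → x - y < x - z → z < y
  -‿cancelˡ-< {x} {y} {z} l = +-cancelʳ-< x (<-resp-≈ (+-comm x z) rearrange
    (+-monoˡ-< z (x-y<z⇒x<z+y l)))
    where
    rearrange : ((x - z) + y) + z ≈ y + x
    rearrange = trans (+-congʳ (+-comm _ y)) (trans (+-assoc y _ z) (+-congˡ (x-y+y≈x x z)))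

  *-distribˡ-- : ∀ z x y → z * (x - y) ≈ z * x - z * y
  *-distribˡ-- z x y = trans (distribˡ z x (- y)) (+-congˡ (sym (-‿distribʳ-* z y)))

  *-monoʳ-< : ∀ {z x y} → 0# < z → x < y → z * x < z * y
  *-monoʳ-< {z} {x} {y} 0<z x<y = 0<y-x⇒x<y (<.<-respʳ-≈ (*-distribˡ-- z y x) (0<x*y 0<z (x<y⇒0<y-x x<y)))

  reciprocal : ∀ {x} → 0# < x → ∃[ y ] 0# < y × y * x ≈ 1#
  reciprocal {x} 0<x with #⇒invertible (#-sym (<⇒# 0<x))
  ... | y , y[x-0]≈1 , [x-0]y≈1 = y , 0<y , yx≈1
    where
    x-0≈x : x - 0# ≈ x
    x-0≈x = trans (+-congˡ -0#≈0#) (+-identityʳ x)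
    yx≈1 : y * x ≈ 1#
    yx≈1 = trans (*-congˡ (sym x-0≈x)) y[x-0]≈1
    y-0≈y : y - 0# ≈ y
    y-0≈y = trans (+-congˡ -0#≈0#) (+-identityʳ y)
    y#0 : y # 0#
    y#0 = invertible⇒# (x , trans (*-congˡ y-0≈y) (trans (*-comm x y) yx≈1) , trans (*-congʳ y-0≈y) yx≈1)
    0<y : 0# < y
    0<y with #⇒<∨> y#0
    ... | inj₂ 0<y = 0<y
    ... | inj₁ y<0 = contradiction
      (<-resp-≈ (trans (*-comm x y) yx≈1) (zeroʳ x) (*-monoʳ-< 0<x y<0)) (<.asym 0<1)

  *-cancelˡ-< : ∀ {z x y} → 0# < z → z * x < z * y → x < y
  *-cancelˡ-< {z} 0<z zx<zy with w , 0<w , wz≈1 ← reciprocal 0<z =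
    <-resp-≈ (cancel _) (cancel _) (*-monoʳ-< 0<w zx<zy)
    where
    cancel : ∀ x → w * (z * x) ≈ x
    cancel x = trans (sym (*-assoc w z x)) (trans (*-congʳ wz≈1) (*-identityˡ x))

  -- The signs of `x` and `y` cannot be compared outright. But a negative product is invertible, so
  -- both factors are apart from zero, and then their signs are decided.
  0≤x*y : ∀ {x y} → 0# ≤ x → 0# ≤ y → 0# ≤ x * y
  0≤x*y {x} {y} 0≤x 0≤y xy<0 with #⇒invertible (<⇒# xy<0)
  ... | z , z[xy-0]≈1 , _ with #⇒<∨> x#0 | #⇒<∨> y#0
    where
    xy-0≈xy : x * y - 0# ≈ x * y
    xy-0≈xy = trans (+-congˡ -0#≈0#) (+-identityʳ (x * y))
    zxy≈1 : z * (x * y) ≈ 1#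
    zxy≈1 = trans (*-congˡ (sym xy-0≈xy)) z[xy-0]≈1
    w-0≈w : ∀ w → w - 0# ≈ w
    w-0≈w w = trans (+-congˡ -0#≈0#) (+-identityʳ w)
    left : ∀ {w v} → v * w ≈ 1# → w # 0#
    left {w} {v} vw≈1 = invertible⇒# (v , trans (*-congˡ (w-0≈w w)) vw≈1 , trans (*-congʳ (w-0≈w w)) (trans (*-comm w v) vw≈1))
    y#0 : y # 0#
    y#0 = left (trans (*-assoc z x y) zxy≈1)
    x#0 : x # 0#
    x#0 = left (trans (*-assoc z y x) (trans (*-congˡ (*-comm y x)) zxy≈1))
  ... | inj₁ x<0 | _ = 0≤x x<0
  ... | inj₂ _ | inj₁ y<0 = 0≤y y<0
  ... | inj₂ 0<x | inj₂ 0<y = <.asym xy<0 (0<x*y 0<x 0<y)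

  *-monoʳ-≤ : ∀ {z x y} → 0# ≤ z → x ≤ y → z * x ≤ z * y
  *-monoʳ-≤ {z} {x} {y} 0≤z x≤y = 0≤y-x⇒x≤y (≤-resp-≈ refl (*-distribˡ-- z y x) (0≤x*y 0≤z (x≤y⇒0≤y-x x≤y)))

  *-monoˡ-≤ : ∀ {z x y} → 0# ≤ z → x ≤ y → x * z ≤ y * z
  *-monoˡ-≤ 0≤z x≤y = ≤-resp-≈ (*-comm _ _) (*-comm _ _) (*-monoʳ-≤ 0≤z x≤y)

  ½+½≈1 : ½ + ½ ≈ 1#
  ½+½≈1 = begin
    ½ + ½                  ≈⟨ +-cong (*-identityʳ ½) (*-identityʳ ½) ⟨
    ½ * 1# + ½ * 1#        ≈⟨ distribˡ ½ 1# 1# ⟨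
    ½ * (1# + 1#)          ≈⟨ *-congˡ (trans (+-congˡ -0#≈0#) (+-identityʳ _)) ⟨
    ½ * ((1# + 1#) - 0#)   ≈⟨ proj₁ (proj₂ (#⇒invertible (#-sym (<⇒# 0<2)))) ⟩
    1#                     ∎
    where open ≈-Reasoning

  ½*x+½*x≈x : ∀ x → ½ * x + ½ * x ≈ x
  ½*x+½*x≈x x = trans (sym (distribʳ x ½ ½)) (trans (*-congʳ ½+½≈1) (*-identityˡ x))

  0<½ : 0# < ½
  0<½ with <-cotrans (0<1) ½
  ... | inj₁ 0<½ = 0<½
  ... | inj₂ ½<1 = +-cancelʳ-< ½ (<-resp-≈ (sym (+-identityˡ ½)) (sym ½+½≈1) ½<1)

  -- Series of non-negative terms.

  partialSum : (ℕ → Carrier) → ℕ → Carrier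
  partialSum u M = sum {M} (u ∘ toℕ)

  NonNegative : (ℕ → Carrier) → Set _
  NonNegative u = ∀ t → 0# ≤ u t

  0≤partialSum : ∀ u → NonNegative u → ∀ M → 0# ≤ partialSum u M
  0≤partialSum u 0≤u zero    = ≤-refl
  0≤partialSum u 0≤u (suc M) = 0≤x+y (0≤u 0) (0≤partialSum (u ∘ suc) (0≤u ∘ suc) M)

  partialSum-mono : ∀ u → NonNegative u → ∀ {M M′} → M ℕ.≤ M′ → partialSum u M ≤ partialSum u M′
  partialSum-mono u 0≤u {M′ = M′} z≤n = 0≤partialSum u 0≤u M′
  partialSum-mono u 0≤u (s≤s M≤M′) = +-monoʳ-≤ _ (partialSum-mono (u ∘ suc) (0≤u ∘ suc) M≤M′)

  partialSum-cong : ∀ u v → (∀ t → u t ≈ v t) → ∀ M → partialSum u M ≈ partialSum v M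
  partialSum-cong u v u≈v M = sum-cong-≋ {M} {u ∘ toℕ} {v ∘ toℕ} (λ i → u≈v (toℕ i))

  HasSum-cong : ∀ u v {s} → (∀ t → u t ≈ v t) → HasSum u s → HasSum v s
  HasSum-cong u v u≈v u⟶s η 0<η with M , close ← u⟶s η 0<η = M , λ i M≤i →
    <-resp-≈ (+-congʳ (partialSum-cong u v u≈v i)) refl (proj₁ (close i M≤i)) ,
    <-resp-≈ (+-congˡ (-‿cong (partialSum-cong u v u≈v i))) refl (proj₂ (close i M≤i))

  partialSum≤HasSum : ∀ u {s} → NonNegative u → HasSum u s → ∀ M → partialSum u M ≤ s
  partialSum≤HasSum u {s} 0≤u u⟶s M s<uM
    with M₀ , close ← u⟶s (partialSum u M - s) (x<y⇒0<y-x s<uM) =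
    partialSum-mono u 0≤u (ℕ.m≤n⊔m M₀ M)
      (<-resp-≈ (x-y+y≈x _ s) (x-y+y≈x _ s) (+-monoˡ-< s (proj₁ (close (M₀ ℕ.⊔ M) (ℕ.m≤m⊔n M₀ M)))))

  HasSum≤ : ∀ u {s b} → HasSum u s → (∀ M → partialSum u M ≤ b) → s ≤ b
  HasSum≤ u {s} {b} u⟶s u≤b b<s with M , close ← u⟶s (s - b) (x<y⇒0<y-x b<s) =
    u≤b M (-‿cancelˡ-< (proj₂ (close M ℕ.≤-refl)))

  -- Made for a series regrouped into finite pieces. As the partial sums of `u` increase, it is
  -- enough that one of them overtakes a partial sum of `v` close to `s`.
  HasSum-squeeze : ∀ u v {s} → NonNegative u → HasSum v s → (∀ M → partialSum u M ≤ s) →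
                   (∀ K → ∃[ M ] partialSum v K ≤ partialSum u M) → HasSum u s
  HasSum-squeeze u v {s} 0≤u v⟶s u≤s v≤u η 0<η
    with K , close ← v⟶s η 0<η
    with M , vK≤uM ← v≤u K = M , λ i M≤i →
      x<z+y⇒x-y<z (≤-<-trans (u≤s i) (<-resp-≈ (+-identityˡ s) refl (+-monoˡ-< s 0<η))) ,
      x<z+y⇒x-y<z (<-≤-trans (x-y<z⇒x<z+y (proj₂ (close K ℕ.≤-refl)))
        (+-monoʳ-≤ η (≤-trans vK≤uM (partialSum-mono u 0≤u M≤i))))

  module _ {κ : Carrier} (0<κ : 0# < κ) {u v : ℕ → Carrier}
           (0≤u : NonNegative u) (0≤v : NonNegative v) (κu≤v : ∀ t → κ * u t ≤ v t) where

    private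
      w : ℕ → Carrier
      w t = v t - κ * u t

      partialSum-w : ∀ M → partialSum w M + κ * partialSum u M ≈ partialSum v M
      partialSum-w M = begin
        partialSum w M + κ * partialSum u M               ≈⟨ +-congˡ (*-distribˡ-sum {M} κ (u ∘ toℕ)) ⟩
        partialSum w M + partialSum (λ t → κ * u t) M     ≈⟨ ∑-distrib-+ {M} (w ∘ toℕ) (λ i → κ * u (toℕ i)) ⟨
        partialSum (λ t → w t + κ * u t) M                ≈⟨ partialSum-cong (λ t → w t + κ * u t) v (λ t → x-y+y≈x (v t) (κ * u t)) M ⟩
        partialSum v M                                    ∎
        where open ≈-Reasoning

      0≤w : NonNegative w
      0≤w t = x≤y⇒0≤y-x (κu≤v t)

      increment : ∀ {i j} → j ℕ.≤ i → κ * partialSum u i + partialSum v j ≤ partialSum v i + κ * partialSum u j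
      increment {i} {j} j≤i = begin
        κ * partialSum u i + partialSum v j                                  ≈⟨ +-congˡ (partialSum-w j) ⟨
        κ * partialSum u i + (partialSum w j + κ * partialSum u j)           ≈⟨ x+[y+z]≈y+[x+z] _ _ _ ⟩
        partialSum w j + (κ * partialSum u i + κ * partialSum u j)           ≲⟨ +-monoˡ-≤ _ (partialSum-mono w 0≤w j≤i) ⟩
        partialSum w i + (κ * partialSum u i + κ * partialSum u j)           ≈⟨ +-assoc _ _ _ ⟨
        (partialSum w i + κ * partialSum u i) + κ * partialSum u j           ≈⟨ +-congʳ (partialSum-w i) ⟩
        partialSum v i + κ * partialSum u j                                  ∎
        where open ≤-Reasoning

    -- The partial sums of `w` increase, so an increment of those of `u`, times `κ`, is at most the
    -- same increment for `v`, and the modulus of `v` at precision `κ * η` serves `u` at `η`.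
    -- Monotonicity and a bound alone would give no modulus.
    comparison-Cauchy : ∀ {s} → HasSum v s → Cauchy (partialSum u)
    comparison-Cauchy {s} v⟶s η 0<η
      with M , close ← v⟶s (κ * η) (0<x*y 0<κ 0<η) = M , bound
      where
      bound : ∀ i j → M ℕ.≤ i → M ℕ.≤ j → partialSum u i - partialSum u j < η
      bound i j M≤i M≤j with ℕ.≤-total i j
      ... | inj₁ i≤j = x<z+y⇒x-y<z (≤-<-trans (partialSum-mono u 0≤u i≤j)
            (<-resp-≈ (+-identityˡ _) refl (+-monoˡ-< _ 0<η)))
      ... | inj₂ j≤i = x<z+y⇒x-y<z (*-cancelˡ-< 0<κ (+-cancelʳ-< (partialSum v j)
            (≤-<-trans (≤-trans (increment j≤i) (+-monoˡ-≤ _ (partialSum≤HasSum v 0≤v v⟶s i)))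
              (<-resp-≈ refl rearrange (+-monoˡ-< (κ * partialSum u j) (x-y<z⇒x<z+y (proj₂ (close j M≤j))))))))
        where
        rearrange : (κ * η + partialSum v j) + κ * partialSum u j ≈ κ * (η + partialSum u j) + partialSum v j
        rearrange = trans (+-assoc _ _ _) (trans (+-congˡ (+-comm _ _))
          (trans (sym (+-assoc _ _ _)) (+-congʳ (sym (distribˡ κ _ _)))))

    -- Costs and errors are relations with no value given in advance; this supplies the value for
    -- the extracted tree along with the bound on it.
    comparison : ∀ {s} → HasSum v s → ∃[ s′ ] HasSum u s′ × κ * s′ ≤ s
    comparison {s} v⟶s with s′ , u⟶s′ ← complete (partialSum u) (comparison-Cauchy v⟶s)
      with ι , 0<ι , ικ≈1 ← reciprocal 0<κ = s′ , u⟶s′ , (begin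
        κ * s′        ≲⟨ *-monoʳ-≤ (<⇒≤ 0<κ) (HasSum≤ u u⟶s′ u≤ιs) ⟩
        κ * (ι * s)   ≈⟨ *-assoc κ ι s ⟨
        (κ * ι) * s   ≈⟨ *-congʳ (trans (*-comm κ ι) ικ≈1) ⟩
        1# * s        ≈⟨ *-identityˡ s ⟩
        s             ∎)
      where
      open ≤-Reasoning
      u≤ιs : ∀ M → partialSum u M ≤ ι * s
      u≤ιs M = begin
        partialSum u M               ≈⟨ *-identityˡ _ ⟨
        1# * partialSum u M          ≈⟨ *-congʳ ικ≈1 ⟨
        (ι * κ) * partialSum u M     ≈⟨ *-assoc ι κ _ ⟩
        ι * (κ * partialSum u M)     ≲⟨ *-monoʳ-≤ (<⇒≤ 0<ι) (≤-trans (y≤x+y (0≤partialSum w 0≤w M))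
                                          (≤-reflexive (partialSum-w M))) ⟩
        ι * partialSum v M           ≲⟨ *-monoʳ-≤ (<⇒≤ 0<ι) (partialSum≤HasSum v 0≤v v⟶s M) ⟩
        ι * s                        ∎

  module _ {b} {B : Set b} where

    listSum : (B → Carrier) → List B → Carrier
    listSum F []       = 0#
    listSum F (x ∷ xs) = F x + listSum F xs

    -- The concatenation x ∷ xs ++ (d ∷ D 0) ++ (d ∷ D 1) ++ ...; the separators d keep it infinite.
    concatenate : B → B → List B → (ℕ → List B) → ℕ → B
    concatenate d x xs       D zero    = x
    concatenate d x []       D (suc m) = concatenate d d (D 0) (D ∘ suc) m
    concatenate d x (y ∷ xs) D (suc m) = concatenate d y xs D m

    module _ (F : B → Carrier) (0≤F : ∀ x → 0# ≤ F x) (d : B) (Fd≈0 : F d ≈ 0#) where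

      0≤listSum : ∀ xs → 0# ≤ listSum F xs
      0≤listSum []       = ≤-refl
      0≤listSum (x ∷ xs) = 0≤x+y (0≤F x) (0≤listSum xs)

      0≤listSums : ∀ (D : ℕ → List B) → NonNegative (λ t → listSum F (D t))
      0≤listSums D t = 0≤listSum (D t)

      -- Every further list is preceded by a separator, so `M` positions reach into at most `M` of
      -- these lists.
      concatenate-upper : ∀ x xs D M → partialSum (F ∘ concatenate d x xs D) M ≤
                          (F x + listSum F xs) + partialSum (λ t → listSum F (D t)) M
      concatenate-upper x xs D zero = 0≤x+y (0≤x+y (0≤F x) (0≤listSum xs)) ≤-refl
      concatenate-upper x [] D (suc M) = begin
        F x + partialSum (F ∘ concatenate d d (D 0) (D ∘ suc)) M
          ≲⟨ +-monoʳ-≤ _ (concatenate-upper d (D 0) (D ∘ suc) M) ⟩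
        F x + ((F d + listSum F (D 0)) + partialSum (λ t → listSum F (D (suc t))) M)
          ≈⟨ +-cong (+-identityʳ _) (+-congʳ (trans (sym (+-identityˡ _)) (+-congʳ (sym Fd≈0)))) ⟨
        (F x + 0#) + partialSum (λ t → listSum F (D t)) (suc M)
          ∎
        where open ≤-Reasoning
      concatenate-upper x (y ∷ xs) D (suc M) = begin
        F x + partialSum (F ∘ concatenate d y xs D) M
          ≲⟨ +-monoʳ-≤ _ (concatenate-upper y xs D M) ⟩
        F x + ((F y + listSum F xs) + partialSum (λ t → listSum F (D t)) M)
          ≈⟨ +-assoc _ _ _ ⟨
        (F x + (F y + listSum F xs)) + partialSum (λ t → listSum F (D t)) M
          ≲⟨ +-monoʳ-≤ _ (partialSum-mono (λ t → listSum F (D t)) (0≤listSums D) (ℕ.n≤1+n M)) ⟩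
        (F x + (F y + listSum F xs)) + partialSum (λ t → listSum F (D t)) (suc M)
          ∎
        where open ≤-Reasoning

      concatenate-lower : ∀ K x xs D → ∃[ M ] (F x + listSum F xs) + partialSum (λ t → listSum F (D t)) K ≤
                                              partialSum (F ∘ concatenate d x xs D) M
      concatenate-lower zero x [] D = 1 , ≤-reflexive (+-identityʳ _)
      concatenate-lower (suc K) x [] D with M , l ← concatenate-lower K d (D 0) (D ∘ suc) = suc M , (begin
        (F x + 0#) + partialSum (λ t → listSum F (D t)) (suc K)
          ≈⟨ +-cong (+-identityʳ _) (+-congʳ (trans (sym (+-identityˡ _)) (+-congʳ (sym Fd≈0)))) ⟩
        F x + ((F d + listSum F (D 0)) + partialSum (λ t → listSum F (D (suc t))) K)
          ≲⟨ +-monoʳ-≤ _ l ⟩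
        F x + partialSum (F ∘ concatenate d d (D 0) (D ∘ suc)) M
          ∎)
        where open ≤-Reasoning
      concatenate-lower K x (y ∷ xs) D with M , l ← concatenate-lower K y xs D =
        suc M , ≤-trans (≤-reflexive (+-assoc _ _ _)) (+-monoʳ-≤ _ l)

      HasSum-concatenate : ∀ D {s} → HasSum (λ t → listSum F (D t)) s → HasSum (F ∘ concatenate d d [] D) s
      HasSum-concatenate D {s} sums = HasSum-squeeze (F ∘ concatenate d d [] D) (λ t → listSum F (D t)) (λ t → 0≤F (concatenate d d [] D t)) sums
        (λ M → ≤-trans (concatenate-upper d [] D M)
          (≤-trans (≤-reflexive (skip-separator _)) (partialSum≤HasSum (λ t → listSum F (D t)) (0≤listSums D) sums M)))
        (λ K → Product.map₂ (≤-trans (≤-reflexive (sym (skip-separator _)))) (concatenate-lower K d [] D))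
        where
        skip-separator : ∀ x → (F d + 0#) + x ≈ x
        skip-separator x = trans (+-congʳ (trans (+-identityʳ _) Fd≈0)) (+-identityˡ x)

-- A symbol carries a flag saying whether its bit was drawn from a fair coin.
Symbol : Set
Symbol = Bool × Bool

flags bits : ∀ {N} → Vec Symbol N → Vec Bool N
flags = map proj₁
bits  = map proj₂

refresh : Symbol → Bool → Symbol
refresh (s , b) w = s , b xor (w ∧ s)

flags-refresh : ∀ {N} (σ : Vec Symbol N) u → flags (zipWith refresh σ u) ≡ flags σ
flags-refresh []            []      = ≡.refl
flags-refresh ((s , b) ∷ σ) (w ∷ u) = ≡.cong (s ∷_) (flags-refresh σ u)

bits-refresh : ∀ {N} (σ : Vec Symbol N) u → bits (zipWith refresh σ u) ≡ bits σ ⊕ zipWith _∧_ u (flags σ)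
bits-refresh []            []      = ≡.refl
bits-refresh ((s , b) ∷ σ) (w ∷ u) = ≡.cong (_ ∷_) (bits-refresh σ u)

-- Finitely supported distributions.

module Distributions {c ℓ₁ ℓ₂} (ℝ : Reals c ℓ₁ ℓ₂) where
  open RealProperties ℝ

  -- Nothing is required of the weights here, so the algebra of expectations needs no side
  -- conditions; `IsProbability` is demanded only where it matters.
  Dist : ∀ {a} → Set a → Set _
  Dist A = List (Carrier × A)

  expect : ∀ {a} {A : Set a} → Dist A → (A → Carrier) → Carrier
  expect []            F = 0#
  expect ((p , a) ∷ D) F = p * F a + expect D F

  return : ∀ {a} {A : Set a} → A → Dist A
  return a = (1# , a) ∷ []

  scale : ∀ {a} {A : Set a} → Carrier → Dist A → Dist A
  scale p = List.map (map₁ (p *_))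

  infixl 1 _>>=_
  _>>=_ : ∀ {a b} {A : Set a} {B : Set b} → Dist A → (A → Dist B) → Dist B
  []            >>= f = []
  ((p , a) ∷ D) >>= f = scale p (f a) List.++ (D >>= f)

  module _ {a} {A : Set a} where

    expect-cong : ∀ (D : Dist A) {F G} → (∀ x → F x ≈ G x) → expect D F ≈ expect D G
    expect-cong []            F≈G = refl
    expect-cong ((p , x) ∷ D) F≈G = +-cong (*-congˡ (F≈G x)) (expect-cong D F≈G)

    expect-++ : ∀ (D D′ : Dist A) F → expect (D List.++ D′) F ≈ expect D F + expect D′ F
    expect-++ []            D′ F = sym (+-identityˡ _)
    expect-++ ((p , x) ∷ D) D′ F = trans (+-congˡ (expect-++ D D′ F)) (sym (+-assoc _ _ _))

    expect-scale : ∀ q (D : Dist A) F → expect (scale q D) F ≈ q * expect D F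
    expect-scale q []            F = sym (zeroʳ q)
    expect-scale q ((p , x) ∷ D) F =
      trans (+-cong (*-assoc q p (F x)) (expect-scale q D F)) (sym (distribˡ q _ _))

    expect-+ : ∀ (D : Dist A) F G → expect D (λ x → F x + G x) ≈ expect D F + expect D G
    expect-+ []            F G = sym (+-identityˡ 0#)
    expect-+ ((p , x) ∷ D) F G =
      trans (+-cong (distribˡ p (F x) (G x)) (expect-+ D F G)) (+-interchange _ _ _ _)

    expect-*ˡ : ∀ (D : Dist A) q F → expect D (λ x → q * F x) ≈ q * expect D F
    expect-*ˡ []            q F = sym (zeroʳ q)
    expect-*ˡ ((p , x) ∷ D) q F =
      trans (+-cong (x*[y*z]≈y*[x*z] p q (F x)) (expect-*ˡ D q F)) (sym (distribˡ q _ _))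

    expect-0 : ∀ (D : Dist A) → expect D (λ _ → 0#) ≈ 0#
    expect-0 []            = refl
    expect-0 ((p , x) ∷ D) = trans (+-cong (zeroʳ p) (expect-0 D)) (+-identityˡ 0#)

    expect-return : ∀ (x : A) F → expect (return x) F ≈ F x
    expect-return x F = trans (+-identityʳ _) (*-identityˡ (F x))

    expect-sum : ∀ (D : Dist A) {m} (F : Fin m → A → Carrier) →
                 expect D (λ x → sum (λ j → F j x)) ≈ sum (λ j → expect D (F j))
    expect-sum D {zero}  F = expect-0 D
    expect-sum D {suc m} F = trans (expect-+ D (F zero) _) (+-congˡ (expect-sum D (F ∘ suc)))

    NonNegativeWeights : Dist A → Set _
    NonNegativeWeights = All ((0# ≤_) ∘ proj₁)

    IsProbability : Dist A → Set _
    IsProbability D = NonNegativeWeights D × expect D (λ _ → 1#) ≈ 1#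

    expect-mono : ∀ {D : Dist A} {F G} → NonNegativeWeights D → (∀ x → F x ≤ G x) → expect D F ≤ expect D G
    expect-mono []        F≤G = ≤-refl
    expect-mono (0≤p ∷ D) F≤G = +-mono-≤ (*-monoʳ-≤ 0≤p (F≤G _)) (expect-mono D F≤G)

    0≤expect : ∀ {D : Dist A} {F} → NonNegativeWeights D → (∀ x → 0# ≤ F x) → 0# ≤ expect D F
    0≤expect {D} D≥0 0≤F = ≤-trans (≤-reflexive (sym (expect-0 D))) (expect-mono D≥0 0≤F)

    expect-const : ∀ {D : Dist A} q → IsProbability D → expect D (λ _ → q) ≈ q
    expect-const {D} q (_ , total) = begin
      expect D (λ _ → q)        ≈⟨ expect-cong D (λ _ → *-identityʳ q) ⟨
      expect D (λ _ → q * 1#)   ≈⟨ expect-*ˡ D q (λ _ → 1#) ⟩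
      q * expect D (λ _ → 1#)   ≈⟨ *-congˡ total ⟩
      q * 1#                    ≈⟨ *-identityʳ q ⟩
      q                         ∎
      where open ≈-Reasoning

    return-isProbability : ∀ x → IsProbability (return x)
    return-isProbability x = <⇒≤ 0<1 ∷ [] , expect-return x _

    scale-nonNegative : ∀ {q} {D : Dist A} → 0# ≤ q → NonNegativeWeights D → NonNegativeWeights (scale q D)
    scale-nonNegative 0≤q D≥0 = All.map⁺ (All.map (0≤x*y 0≤q) D≥0)

  module _ {a b} {A : Set a} {B : Set b} where

    expect->>= : ∀ (D : Dist A) (f : A → Dist B) F → expect (D >>= f) F ≈ expect D (λ x → expect (f x) F)
    expect->>= []            f F = refl
    expect->>= ((p , x) ∷ D) f F = trans (expect-++ (scale p (f x)) _ F)
      (+-cong (expect-scale p (f x) F) (expect->>= D f F))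

    expect-comm : ∀ (D : Dist A) (D′ : Dist B) (F : A → B → Carrier) →
                  expect D (λ x → expect D′ (F x)) ≈ expect D′ (λ y → expect D (λ x → F x y))
    expect-comm []            D′ F = sym (expect-0 D′)
    expect-comm ((p , x) ∷ D) D′ F = begin
      p * expect D′ (F x) + expect D (λ x → expect D′ (F x))
        ≈⟨ +-cong (expect-*ˡ D′ p (F x)) refl ⟨
      expect D′ (λ y → p * F x y) + expect D (λ x → expect D′ (F x))
        ≈⟨ +-congˡ (expect-comm D D′ F) ⟩
      expect D′ (λ y → p * F x y) + expect D′ (λ y → expect D (λ x → F x y))
        ≈⟨ expect-+ D′ _ _ ⟨
      expect D′ (λ y → p * F x y + expect D (λ x → F x y))
        ∎
      where open ≈-Reasoning

    >>=-nonNegative : ∀ {D : Dist A} {f : A → Dist B} → NonNegativeWeights D →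
                      (∀ x → NonNegativeWeights (f x)) → NonNegativeWeights (D >>= f)
    >>=-nonNegative []        f≥0 = []
    >>=-nonNegative (0≤p ∷ D) f≥0 = All.++⁺ (scale-nonNegative 0≤p (f≥0 _)) (>>=-nonNegative D f≥0)

    >>=-isProbability : ∀ {D : Dist A} {f : A → Dist B} → IsProbability D →
                        (∀ x → IsProbability (f x)) → IsProbability (D >>= f)
    >>=-isProbability {D} {f} D-prob f-prob = >>=-nonNegative (proj₁ D-prob) (proj₁ ∘ f-prob) ,
      trans (expect->>= D f _) (trans (expect-cong D (proj₂ ∘ f-prob)) (proj₂ D-prob))

  module _ {a b} {A : Set a} {B : Set b} (δ : B → Dist A) where

    independent : ∀ {N} → Vec B N → Dist (Vec A N)
    independent []       = return []
    independent (b ∷ bs) = δ b >>= λ x → independent bs >>= λ xs → return (x ∷ xs)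

    expect-∷ : ∀ {N} b (bs : Vec B N) F →
               expect (independent (b ∷ bs)) F ≈ expect (δ b) (λ x → expect (independent bs) (λ xs → F (x ∷ xs)))
    expect-∷ b bs F = trans (expect->>= (δ b) _ F) (expect-cong (δ b) λ x →
      trans (expect->>= (independent bs) _ F) (expect-cong (independent bs) λ xs → expect-return (x ∷ xs) F))

    expect-independent-++ : ∀ {M N} (bs : Vec B M) (cs : Vec B N) F →
      expect (independent (bs ++ cs)) F ≈
      expect (independent bs) (λ xs → expect (independent cs) (λ ys → F (xs ++ ys)))
    expect-independent-++ []       cs F = sym (expect-return [] (λ xs → expect (independent cs) (λ ys → F (xs ++ ys))))
    expect-independent-++ (b ∷ bs) cs F = trans (expect-∷ b (bs ++ cs) F)
      (trans (expect-cong (δ b) (λ x → expect-independent-++ bs cs (F ∘ (x ∷_))))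
             (sym (expect-∷ b bs (λ xs → expect (independent cs) (λ ys → F (xs ++ ys))))))

    independent-isProbability : ∀ {N} {bs : Vec B N} → VecAll.All (IsProbability ∘ δ) bs → IsProbability (independent bs)
    independent-isProbability VecAll.[] = return-isProbability []
    independent-isProbability (b VecAll.∷ bs) =
      >>=-isProbability b λ x → >>=-isProbability (independent-isProbability bs) λ xs → return-isProbability (x ∷ xs)

  expect-independent-map : ∀ {a a′ b} {A : Set a} {A′ : Set a′} {B : Set b} (δ : B → Dist A) (δ′ : B → Dist A′) (g : A → A′) →
    (∀ b F → expect (δ b) (F ∘ g) ≈ expect (δ′ b) F) →
    ∀ {N} (bs : Vec B N) F → expect (independent δ bs) (F ∘ Vec.map g) ≈ expect (independent δ′ bs) F
  expect-independent-map δ δ′ g marginal []       F = refl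
  expect-independent-map δ δ′ g marginal (b ∷ bs) F = begin
    expect (independent δ (b ∷ bs)) (F ∘ Vec.map g)
      ≈⟨ expect-∷ δ b bs (F ∘ Vec.map g) ⟩
    expect (δ b) (λ x → expect (independent δ bs) (λ xs → F (g x ∷ Vec.map g xs)))
      ≈⟨ expect-cong (δ b) (λ x → expect-independent-map δ δ′ g marginal bs (F ∘ (g x ∷_))) ⟩
    expect (δ b) (λ x → expect (independent δ′ bs) (λ xs → F (g x ∷ xs)))
      ≈⟨ marginal b (λ x → expect (independent δ′ bs) (λ xs → F (x ∷ xs))) ⟩
    expect (δ′ b) (λ x → expect (independent δ′ bs) (λ xs → F (x ∷ xs)))
      ≈⟨ expect-∷ δ′ b bs F ⟨
    expect (independent δ′ (b ∷ bs)) F ∎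
    where open ≈-Reasoning

  indicator : Bool → Carrier
  indicator b = if b then 1# else 0#

  0≤indicator : ∀ b → 0# ≤ indicator b
  0≤indicator true  = <⇒≤ 0<1
  0≤indicator false = ≤-refl

  coin : Carrier → Dist Bool
  coin p = (1# - p , false) ∷ (p , true) ∷ []

  coin-isProbability : ∀ {p} → 0# ≤ p → p ≤ 1# → IsProbability (coin p)
  coin-isProbability {p} 0≤p p≤1 = x≤y⇒0≤y-x p≤1 ∷ 0≤p ∷ [] , (begin
    (1# - p) * 1# + (p * 1# + 0#)  ≈⟨ +-cong (*-identityʳ _) (trans (+-identityʳ _) (*-identityʳ p)) ⟩
    (1# - p) + p                   ≈⟨ x-y+y≈x 1# p ⟩
    1#                             ∎)
    where open ≈-Reasoning

  fair : Dist Bool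
  fair = (½ , false) ∷ (½ , true) ∷ []

  fair-isProbability : IsProbability fair
  fair-isProbability = <⇒≤ 0<½ ∷ <⇒≤ 0<½ ∷ [] , (begin
    ½ * 1# + (½ * 1# + 0#)  ≈⟨ +-congˡ (+-identityʳ _) ⟩
    ½ * 1# + ½ * 1#         ≈⟨ ½*x+½*x≈x 1# ⟩
    1#                      ∎)
    where open ≈-Reasoning

  expect-fair : ∀ F → expect fair F ≈ ½ * F false + ½ * F true
  expect-fair F = +-congˡ (+-identityʳ _)

  uniform : ∀ N → Dist (Vec Bool N)
  uniform N = independent (λ _ → fair) (replicate N tt)

  uniform-isProbability : ∀ N → IsProbability (uniform N)
  uniform-isProbability N = independent-isProbability (λ _ → fair) (VecAll.universal (λ _ → fair-isProbability) (replicate N tt))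

  expect-uniform-suc : ∀ N F → expect (uniform (suc N)) F ≈ expect fair (λ x → expect (uniform N) (λ u → F (x ∷ u)))
  expect-uniform-suc N F = expect-∷ (λ _ → fair) tt (replicate N tt) F

  expect-uniform-⊕ : ∀ {N} w F → expect (uniform N) (λ u → F (u ⊕ w)) ≈ expect (uniform N) F
  expect-uniform-⊕ {zero}  []       F = refl
  expect-uniform-⊕ {suc N} (w ∷ ws) F = begin
    expect (uniform (suc N)) (λ u → F (u ⊕ (w ∷ ws)))
      ≈⟨ expect-uniform-suc N (λ u → F (u ⊕ (w ∷ ws))) ⟩
    expect fair (λ x → expect (uniform N) (λ u → F ((x xor w) ∷ (u ⊕ ws))))
      ≈⟨ expect-cong fair (λ x → expect-uniform-⊕ ws (λ u → F ((x xor w) ∷ u))) ⟩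
    expect fair (λ x → expect (uniform N) (λ u → F ((x xor w) ∷ u)))
      ≈⟨ flipped w (λ x → expect (uniform N) (λ u → F (x ∷ u))) ⟩
    expect fair (λ x → expect (uniform N) (λ u → F (x ∷ u)))
      ≈⟨ expect-uniform-suc N F ⟨
    expect (uniform (suc N)) F
      ∎
    where
    open ≈-Reasoning
    flipped : ∀ w G → expect fair (λ x → G (x xor w)) ≈ expect fair G
    flipped false G = refl
    flipped true  G = trans (expect-fair (λ x → G (x xor true))) (trans (+-comm _ _) (sym (expect-fair G)))

  -- Biased bits with flags.

  module Flagged (h : Carrier) (0≤h : 0# ≤ h) where

    -- With probability 2h the bit comes from a fair coin; the remaining mass makes its bias p.
    symbol : Carrier → Dist Symbol
    symbol p = (h , true , false) ∷ (h , true , true) ∷ (1# - h - p , false , false) ∷ (p - h , false , true) ∷ []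

    Admissible : Carrier → Set _
    Admissible p = h ≤ p × p ≤ 1# - h

    private
      1-h-p+h : ∀ p → h + (1# - h - p) ≈ 1# - p
      1-h-p+h p = trans (sym (+-assoc _ _ _)) (+-congʳ (trans (+-comm h _) (x-y+y≈x 1# h)))

    expect-symbol-bits : ∀ p F → expect (symbol p) (F ∘ proj₂) ≈ expect (coin p) F
    expect-symbol-bits p F = begin
      h * x + (h * y + ((1# - h - p) * x + ((p - h) * y + 0#)))
        ≈⟨ +-congˡ (x+[y+z]≈y+[x+z] _ _ _) ⟩
      h * x + ((1# - h - p) * x + (h * y + ((p - h) * y + 0#)))
        ≈⟨ +-assoc _ _ _ ⟨
      (h * x + (1# - h - p) * x) + (h * y + ((p - h) * y + 0#))
        ≈⟨ +-cong (distribʳ x h _) (trans (+-congʳ (distribʳ y h _)) (+-assoc _ _ _)) ⟨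
      (h + (1# - h - p)) * x + ((h + (p - h)) * y + 0#)
        ≈⟨ +-cong (*-congʳ (1-h-p+h p)) (+-congʳ (*-congʳ (trans (+-comm h _) (x-y+y≈x p h)))) ⟩
      (1# - p) * x + (p * y + 0#)
        ∎
      where
      open ≈-Reasoning
      x = F false
      y = F true

    symbol-isProbability : ∀ {p} → Admissible p → IsProbability (symbol p)
    symbol-isProbability {p} (h≤p , p≤1-h) =
      0≤h ∷ 0≤h ∷ x≤y⇒0≤y-x p≤1-h ∷ x≤y⇒0≤y-x h≤p ∷ [] ,
      trans (expect-symbol-bits p (λ _ → 1#))
            (proj₂ (coin-isProbability {p} (≤-trans 0≤h h≤p) (≤-trans p≤1-h (0≤y-x⇒x≤y (≤-trans 0≤h (≤-reflexive (sym 1-[1-h]≈h)))))))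
      where
      1-[1-h]≈h : 1# - (1# - h) ≈ h
      1-[1-h]≈h = begin
        1# - (1# - h)              ≈⟨ +-congʳ (x-y+y≈x 1# h) ⟨
        ((1# - h) + h) - (1# - h)  ≈⟨ +-congʳ (+-comm _ _) ⟩
        (h + (1# - h)) - (1# - h)  ≈⟨ x+y-y≈x h (1# - h) ⟩
        h                          ∎
        where open ≈-Reasoning

    expect-refresh-symbol : ∀ p F → expect (symbol p) (λ s → expect fair (λ w → F (refresh s w))) ≈ expect (symbol p) F
    expect-refresh-symbol p F = trans (sym (+-assoc _ _ _)) (trans (+-cong free (+-cong (*-congˡ fixed) (+-congʳ (*-congˡ fixed)))) (+-assoc _ _ _))
      where
      x = F (true , false)
      y = F (true , true)
      fixed : ∀ {z} → ½ * z + (½ * z + 0#) ≈ z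
      fixed = trans (+-congˡ (+-identityʳ _)) (½*x+½*x≈x _)
      free : h * (½ * x + (½ * y + 0#)) + h * (½ * y + (½ * x + 0#)) ≈ h * x + h * y
      free = begin
        h * (½ * x + (½ * y + 0#)) + h * (½ * y + (½ * x + 0#))
          ≈⟨ distribˡ h _ _ ⟨
        h * ((½ * x + (½ * y + 0#)) + (½ * y + (½ * x + 0#)))
          ≈⟨ *-congˡ (+-cong (+-congˡ (+-identityʳ _)) (trans (+-congˡ (+-identityʳ _)) (+-comm _ _))) ⟩
        h * ((½ * x + ½ * y) + (½ * x + ½ * y))
          ≈⟨ *-congˡ (trans (+-interchange _ _ _ _) (+-cong (½*x+½*x≈x x) (½*x+½*x≈x y))) ⟩
        h * (x + y)
          ≈⟨ distribˡ h x y ⟩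
        h * x + h * y
          ∎
        where open ≈-Reasoning

    symbols : ∀ {N} → Vec Carrier N → Dist (Vec Symbol N)
    symbols = independent symbol

    symbols-isProbability : ∀ {N} {ps : Vec Carrier N} → VecAll.All Admissible ps → IsProbability (symbols ps)
    symbols-isProbability adm = independent-isProbability symbol (VecAll.map symbol-isProbability adm)

    expect-symbols-bits : ∀ {N} (ps : Vec Carrier N) F →
                          expect (symbols ps) (F ∘ bits) ≈ expect (independent coin ps) F
    expect-symbols-bits = expect-independent-map symbol coin proj₂ expect-symbol-bits

    -- A flagged bit is uniform given the flags and all other bits, so adding an independent coin to
    -- it leaves the joint law as it was. This is what allows the flagged bits to be sampled as late
    -- as needed.
    expect-refresh : ∀ {N} (ps : Vec Carrier N) F →
      expect (symbols ps) (λ σ → expect (uniform _) (λ u → F (zipWith refresh σ u))) ≈ expect (symbols ps) F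
    expect-refresh []       F = expect-cong (symbols []) {λ σ → expect (uniform 0) (λ u → F (zipWith refresh σ u))} {F} λ { [] → expect-return [] (λ u → F (zipWith refresh [] u)) }
    expect-refresh (p ∷ ps) F = begin
      expect (symbols (p ∷ ps)) (λ σ → expect (uniform (suc _)) (λ u → F (zipWith refresh σ u)))
        ≈⟨ expect-∷ symbol p ps _ ⟩
      expect (symbol p) (λ s → expect (symbols ps) (λ σ → expect (uniform (suc _)) (λ u → F (zipWith refresh (s ∷ σ) u))))
        ≈⟨ expect-cong (symbol p) (λ s → expect-cong (symbols ps) (λ σ → expect-uniform-suc _ (λ u → F (zipWith refresh (s ∷ σ) u)))) ⟩
      expect (symbol p) (λ s → expect (symbols ps) (λ σ → expect fair (λ w → expect (uniform _) (λ u → F (refresh s w ∷ zipWith refresh σ u)))))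
        ≈⟨ expect-cong (symbol p) (λ s → expect-comm (symbols ps) fair (λ σ w → expect (uniform _) (λ u → F (refresh s w ∷ zipWith refresh σ u)))) ⟩
      expect (symbol p) (λ s → expect fair (λ w → expect (symbols ps) (λ σ → expect (uniform _) (λ u → F (refresh s w ∷ zipWith refresh σ u)))))
        ≈⟨ expect-cong (symbol p) (λ s → expect-cong fair (λ w → expect-refresh ps (λ σ → F (refresh s w ∷ σ)))) ⟩
      expect (symbol p) (λ s → expect fair (λ w → expect (symbols ps) (λ σ → F (refresh s w ∷ σ))))
        ≈⟨ expect-refresh-symbol p (λ s → expect (symbols ps) (λ σ → F (s ∷ σ))) ⟩
      expect (symbol p) (λ s → expect (symbols ps) (λ σ → F (s ∷ σ)))
        ≈⟨ expect-∷ symbol p ps F ⟨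
      expect (symbols (p ∷ ps)) F
        ∎
      where open ≈-Reasoning

    setFlag : Bool → Symbol → Symbol
    setFlag s (_ , b) = s , b

    -- Given its bit, a symbol is flagged with probability h / p or h / (1 - p), hence at least h.
    flagged-symbol : ∀ {p} → Admissible p → ∀ F → (∀ s → 0# ≤ F s) → (∀ s f → F (setFlag f s) ≈ F s) →
                     h * expect (symbol p) F ≤ expect (symbol p) (λ s → indicator (proj₁ s) * F s)
    flagged-symbol {p} adm@(h≤p , p≤1-h) F 0≤F invariant = begin
      h * expect (symbol p) F
        ≈⟨ *-congˡ (expect-cong (symbol p) (λ { (s , b) → invariant (s , b) true })) ⟨
      h * expect (symbol p) (λ s → F (true , proj₂ s))
        ≈⟨ *-congˡ (expect-symbol-bits p (λ b → F (true , b))) ⟩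
      h * ((1# - p) * x + (p * y + 0#))
        -- Either value of the bit has probability at most 1 and occurs flagged with weight exactly
        -- `h`; this replaces a division by `p` or `1 - p`.
        ≲⟨ *-monoʳ-≤ 0≤h (+-mono-≤ (*≤ 1-p≤1 (0≤F _)) (+-monoˡ-≤ 0# (*≤ p≤1 (0≤F _)))) ⟩
      h * (x + (y + 0#))
        ≈⟨ trans (*-congˡ (+-congˡ (+-identityʳ y))) (distribˡ h x y) ⟩
      h * x + h * y
        ≈⟨ +-cong (*-congˡ (*-identityˡ x)) (trans (+-congˡ rest≈0) (trans (+-identityʳ _) (*-congˡ (*-identityˡ y)))) ⟨
      expect (symbol p) (λ s → indicator (proj₁ s) * F s)
        ∎
      where
      open ≤-Reasoning
      x = F (true , false)
      y = F (true , true)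
      *≤ : ∀ {q z} → q ≤ 1# → 0# ≤ z → q * z ≤ z
      *≤ q≤1 0≤z = ≤-resp-≈ refl (*-identityˡ _) (*-monoˡ-≤ 0≤z q≤1)
      0≤p = ≤-trans 0≤h h≤p
      1-p≤1 : 1# - p ≤ 1#
      1-p≤1 = ≤-trans (x≤x+y 0≤p) (≤-reflexive (x-y+y≈x 1# p))
      p≤1 : p ≤ 1#
      p≤1 = ≤-trans p≤1-h (≤-trans (x≤x+y 0≤h) (≤-reflexive (x-y+y≈x 1# h)))
      rest≈0 : (1# - h - p) * (0# * F (false , false)) + ((p - h) * (0# * F (false , true)) + 0#) ≈ 0#
      rest≈0 = trans (+-cong (trans (*-congˡ (zeroˡ _)) (zeroʳ _)) (trans (+-identityʳ _) (trans (*-congˡ (zeroˡ _)) (zeroʳ _)))) (+-identityʳ 0#)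

    flagged-symbols : ∀ {N} {ps : Vec Carrier N} → VecAll.All Admissible ps → ∀ c F → (∀ σ → 0# ≤ F σ) →
                      (∀ σ f → F (σ [ c ]%= setFlag f) ≈ F σ) →
                      h * expect (symbols ps) F ≤ expect (symbols ps) (λ σ → indicator (lookup (flags σ) c) * F σ)
    flagged-symbols {ps = p ∷ ps} (adm VecAll.∷ adms) zero F 0≤F invariant = begin
      h * expect (symbols (p ∷ ps)) F
        ≈⟨ *-congˡ (expect-∷ symbol p ps F) ⟩
      h * expect (symbol p) (λ s → expect (symbols ps) (λ σ → F (s ∷ σ)))
        ≲⟨ flagged-symbol adm (λ s → expect (symbols ps) (λ σ → F (s ∷ σ))) (λ s → 0≤expect (proj₁ (symbols-isProbability adms)) (λ σ → 0≤F (s ∷ σ)))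
             (λ s f → expect-cong (symbols ps) (λ σ → invariant (s ∷ σ) f)) ⟩
      expect (symbol p) (λ s → indicator (proj₁ s) * expect (symbols ps) (λ σ → F (s ∷ σ)))
        ≈⟨ expect-cong (symbol p) (λ s → expect-*ˡ (symbols ps) (indicator (proj₁ s)) (λ σ → F (s ∷ σ))) ⟨
      expect (symbol p) (λ s → expect (symbols ps) (λ σ → indicator (proj₁ s) * F (s ∷ σ)))
        ≈⟨ expect-∷ symbol p ps _ ⟨
      expect (symbols (p ∷ ps)) (λ σ → indicator (lookup (flags σ) zero) * F σ)
        ∎
      where open ≤-Reasoning
    flagged-symbols {ps = p ∷ ps} (adm VecAll.∷ adms) (suc c) F 0≤F invariant = begin
      h * expect (symbols (p ∷ ps)) F
        ≈⟨ *-congˡ (expect-∷ symbol p ps F) ⟩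
      h * expect (symbol p) (λ s → expect (symbols ps) (λ σ → F (s ∷ σ)))
        ≈⟨ expect-*ˡ (symbol p) h (λ s → expect (symbols ps) (λ σ → F (s ∷ σ))) ⟨
      expect (symbol p) (λ s → h * expect (symbols ps) (λ σ → F (s ∷ σ)))
        ≲⟨ expect-mono (proj₁ (symbol-isProbability adm)) (λ s →
             flagged-symbols adms c (F ∘ (s ∷_)) (λ σ → 0≤F (s ∷ σ)) (λ σ → invariant (s ∷ σ))) ⟩
      expect (symbol p) (λ s → expect (symbols ps) (λ σ → indicator (lookup (flags σ) c) * F (s ∷ σ)))
        ≈⟨ expect-∷ symbol p ps _ ⟨
      expect (symbols (p ∷ ps)) (λ σ → indicator (lookup (flags σ) (suc c)) * F σ)
        ∎
      where open ≤-Reasoning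

-- Planting an input in a block.

module _ {a} {A : Set a} where

  take-++ : ∀ {m n} (xs : Vec A m) (ys : Vec A n) → take m (xs ++ ys) ≡ xs
  take-++ {m} xs ys = proj₁ (++-injective (take m (xs ++ ys)) xs (take++drop≡id m (xs ++ ys)))

  drop-++ : ∀ {m n} (xs : Vec A m) (ys : Vec A n) → drop m (xs ++ ys) ≡ ys
  drop-++ {m} xs ys = proj₂ (++-injective (take m (xs ++ ys)) xs (take++drop≡id m (xs ++ ys)))

  merge : ∀ {k n} → Fin k → Vec A n → Vec A (k ℕ.* n) → Vec A (k ℕ.* n)
  merge {n = n} zero    x z = x ++ drop n z
  merge {n = n} (suc i) x z = take n z ++ merge i x (drop n z)

  lookup-merge-other : ∀ {k n} (i : Fin k) (x : Vec A n) z c → quotient n c ≢ i →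
                       lookup (merge i x z) c ≡ lookup z c
  lookup-merge-other {suc k} {n} zero x z c c∉i
    rewrite lookup-splitAt n x (drop n z) c
    with eq ← lookup-splitAt n (take n z) (drop n z) c
    rewrite take++drop≡id n z
    with splitAt n c
  ... | inj₁ _ = contradiction ≡.refl c∉i
  ... | inj₂ _ = ≡.sym eq
  lookup-merge-other {suc k} {n} (suc i) x z c c∉i
    rewrite lookup-splitAt n (take n z) (merge i x (drop n z)) c
    with eq ← lookup-splitAt n (take n z) (drop n z) c
    rewrite take++drop≡id n z
    with splitAt n c
  ... | inj₁ _  = ≡.sym eq
  ... | inj₂ c′ = ≡.trans (lookup-merge-other i x (drop n z) c′ (c∉i ∘ ≡.cong suc)) (≡.sym eq)

  lookup-merge-own : ∀ {k n} (i : Fin k) (x : Vec A n) z z′ c → quotient n c ≡ i →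
                     lookup (merge i x z) c ≡ lookup (merge i x z′) c
  lookup-merge-own {suc k} {n} zero x z z′ c c∈i
    rewrite lookup-splitAt n x (drop n z) c | lookup-splitAt n x (drop n z′) c
    with splitAt n c
  ... | inj₁ _ = ≡.refl
  ... | inj₂ _ with () ← c∈i
  lookup-merge-own {suc k} {n} (suc i) x z z′ c c∈i
    rewrite lookup-splitAt n (take n z) (merge i x (drop n z)) c
          | lookup-splitAt n (take n z′) (merge i x (drop n z′)) c
    with splitAt n c
  ... | inj₁ _ with () ← c∈i
  ... | inj₂ c′ = lookup-merge-own i x (drop n z) (drop n z′) c′ (Fin.suc-injective c∈i)

map-merge : ∀ {a b} {A : Set a} {B : Set b} (g : A → B) {k n} (i : Fin k) (x : Vec A n) z →
            map g (merge i x z) ≡ merge i (map g x) (map g z)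
map-merge g {n = n} zero    x z = ≡.trans (map-++ g x (drop n z)) (≡.cong (map g x ++_) (≡.sym (drop-map g n z)))
map-merge g {n = n} (suc i) x z = ≡.trans (map-++ g (take n z) _)
  (≡.cong₂ _++_ (≡.sym (take-map g n z))
    (≡.trans (map-merge g i x (drop n z)) (≡.cong (merge i (map g x)) (≡.sym (drop-map g n z)))))

blocks-++ : ∀ k {n} (x : Input n) (r : Input (k ℕ.* n)) → blocks (suc k) (x ++ r) ≡ x ∷ blocks k r
blocks-++ k {n} x r with Vec.splitAt n (x ++ r)
... | ys , zs , eq with ≡.refl , ≡.refl ← ++-injective x ys eq = ≡.refl

blocks-suc : ∀ k {n} (z : Input (suc k ℕ.* n)) → blocks (suc k) z ≡ take n z ∷ blocks k (drop n z)
blocks-suc k {n} z = ≡.trans (≡.cong (blocks (suc k)) (≡.sym (take++drop≡id n z))) (blocks-++ k (take n z) (drop n z))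

block : ∀ {k n} → Fin k → Input (k ℕ.* n) → Input n
block {k} i z = lookup (blocks k z) i

block-merge : ∀ {k n} (i : Fin k) (x : Input n) z → block i (merge i x z) ≡ x
block-merge {suc k} {n} zero    x z = ≡.cong (λ v → lookup v zero) (blocks-++ k x (drop n z))
block-merge {suc k} {n} (suc i) x z = ≡.trans
  (≡.cong (λ v → lookup v (suc i)) (blocks-++ k (take n z) (merge i x (drop n z)))) (block-merge i x (drop n z))

dot-take-drop : ∀ {m n} (v : Vec Bool (m ℕ.+ n)) (x : Vec Bool m) (y : Vec Bool n) →
                ⟨ v , x ++ y ⟩ ≡ ⟨ take m v , x ⟩ xor ⟨ drop m v , y ⟩
dot-take-drop {m} v x y = ≡.trans (≡.cong (λ w → ⟨ w , x ++ y ⟩) (≡.sym (take++drop≡id m v)))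
  (dot-++ (take m v) x (drop m v) y)

-- Isolates what a parity asks about the planted input: `block i v` becomes the query put to `x`,
-- and the remaining term does not depend on `x`.
dot-merge : ∀ {k n} (i : Fin k) (v : Input (k ℕ.* n)) x z →
            ⟨ v , merge i x z ⟩ ≡ ⟨ block i v , x ⟩ xor ⟨ v , merge i (replicate n false) z ⟩
dot-merge {suc k} {n} zero v x z = ≡.trans (dot-take-drop v x (drop n z)) (≡.cong₂ _xor_
  (≡.cong (λ w → ⟨ lookup w zero , x ⟩) (≡.sym (blocks-suc k v)))
  (≡.sym (≡.trans (dot-take-drop v (replicate n false) (drop n z)) (≡.cong (_xor ⟨ drop n v , drop n z ⟩) (dot-zeroʳ (take n v))))))
dot-merge {suc k} {n} (suc i) v x z = begin
  ⟨ v , merge (suc i) x z ⟩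
    ≡⟨ dot-take-drop v (take n z) _ ⟩
  t xor ⟨ drop n v , merge i x (drop n z) ⟩
    ≡⟨ ≡.cong (t xor_) (dot-merge i (drop n v) x (drop n z)) ⟩
  t xor (⟨ block i (drop n v) , x ⟩ xor d)
    ≡⟨ xor-left-comm t ⟨ block i (drop n v) , x ⟩ d ⟩
  ⟨ block i (drop n v) , x ⟩ xor (t xor d)
    ≡⟨ ≡.cong₂ _xor_ (≡.cong (λ w → ⟨ lookup w (suc i) , x ⟩) (≡.sym (blocks-suc k v)))
                     (≡.sym (dot-take-drop v (take n z) _)) ⟩
  ⟨ block (suc i) v , x ⟩ xor ⟨ v , merge (suc i) (replicate n false) z ⟩
    ∎
  where
  open ≡.≡-Reasoning
  t = ⟨ take n v , take n z ⟩
  d = ⟨ drop n v , merge i (replicate n false) (drop n z) ⟩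

lookup-extensionality : ∀ {a} {A : Set a} {N} (xs ys : Vec A N) → (∀ c → lookup xs c ≡ lookup ys c) → xs ≡ ys
lookup-extensionality []       []       eq = ≡.refl
lookup-extensionality (x ∷ xs) (y ∷ ys) eq = ≡.cong₂ _∷_ (eq zero) (lookup-extensionality xs ys (eq ∘ suc))

-- Simulating a tree on a planted input.

module Simulation {c ℓ₁ ℓ₂} (ℝ : Reals c ℓ₁ ℓ₂) {k n : ℕ} (i : Fin k) (s y : Vec Bool (k ℕ.* n)) where
  open RealProperties ℝ
  open Distributions ℝ
  open Pivots {k ℕ.* n} {k} (quotient n)

  private
    N = k ℕ.* n
    S : Region N
    S = lookup s

  -- The tree is run on y with the real input planted in block i.  The bits of y flagged by s are never
  -- looked at: an answer that they leave undetermined is a coin toss, which fixes one linear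
  -- constraint on them.
  simulate : Constraints N → PDT N k → Dist (PDT n 1)
  simulate V (leaf l) = return (leaf (lookup l i ∷ []))
  simulate V (node a t₀ t₁) with inSpan? V (region i N S) a
  ... | yes p with v , β , _ ← span⇒determined V p =
    if β xor ⟨ v , merge i (replicate n false) y ⟩
      then simulate ((a , true) ∷ V) t₁ else simulate ((a , false) ∷ V) t₀
  ... | no _ with inSpan? V (region i 0 S) a
  ...   | no _ = fair >>= λ b → if b then simulate ((a , true) ∷ V) t₁ else simulate ((a , false) ∷ V) t₀
  ...   | yes p with v , β , _ ← span⇒determined V p =
    -- Both subtrees are sampled, independently, since the answer is not yet known. The answer to
    -- `a` is that to `block i v` shifted by a known bit; a shift by 1 swaps the subtrees.
    simulate ((a , true) ∷ V) t₁ >>= λ u₁ → simulate ((a , false) ∷ V) t₀ >>= λ u₀ →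
    return (if β xor ⟨ v , merge i (replicate n false) y ⟩ then node (block i v) u₁ u₀ else node (block i v) u₀ u₁)

  simulate-isProbability : ∀ V t → IsProbability (simulate V t)
  simulate-isProbability V (leaf l) = return-isProbability _
  simulate-isProbability V (node a t₀ t₁) with inSpan? V (region i N S) a
  ... | yes p with v , β , _ ← span⇒determined V p = by-answer (β xor ⟨ v , merge i (replicate n false) y ⟩)
    where
    by-answer : ∀ b → IsProbability (if b then simulate ((a , true) ∷ V) t₁ else simulate ((a , false) ∷ V) t₀)
    by-answer true  = simulate-isProbability _ t₁
    by-answer false = simulate-isProbability _ t₀
  ... | no _ with inSpan? V (region i 0 S) a
  ...   | no _ = >>=-isProbability
            {f = λ b → if b then simulate ((a , true) ∷ V) t₁ else simulate ((a , false) ∷ V) t₀}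
            fair-isProbability λ where
              true  → simulate-isProbability _ t₁
              false → simulate-isProbability _ t₀
  ...   | yes p with v , β , _ ← span⇒determined V p =
            >>=-isProbability (simulate-isProbability _ t₁) λ u₁ →
            >>=-isProbability (simulate-isProbability _ t₀) λ u₀ → return-isProbability _

  satisfied : Constraints N → Input N → Bool
  satisfied []            z = true
  satisfied ((g , b) ∷ V) z = does (⟨ g , z ⟩ Bool.≟ b) ∧ satisfied V z

  satisfied⇒Satisfies : ∀ V z → satisfied V z ≡ true → Satisfies V z
  satisfied⇒Satisfies []            z eq = []
  satisfied⇒Satisfies ((g , b) ∷ V) z eq with gz , Vz ← ∧-true eq =
    does-true (⟨ g , z ⟩ Bool.≟ b) gz ∷ satisfied⇒Satisfies V z Vz

  frozen : ∀ x u c → quotient n c ≢ i → S c ≡ false →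
           lookup (merge i x (y ⊕ zipWith _∧_ u s)) c ≡ lookup (merge i (replicate n false) y) c
  frozen x u c c∉i Sc = begin
    lookup (merge i x (y ⊕ zipWith _∧_ u s)) c     ≡⟨ lookup-merge-other i x _ c c∉i ⟩
    lookup (y ⊕ zipWith _∧_ u s) c                 ≡⟨ lookup-⊕ y _ c ⟩
    lookup y c xor lookup (zipWith _∧_ u s) c      ≡⟨ ≡.cong (lookup y c xor_) (lookup-zipWith _∧_ c u s) ⟩
    lookup y c xor (lookup u c ∧ S c)              ≡⟨ ≡.cong (λ b → lookup y c xor (lookup u c ∧ b)) Sc ⟩
    lookup y c xor (lookup u c ∧ false)            ≡⟨ ≡.cong (lookup y c xor_) (Bool.∧-zeroʳ _) ⟩
    lookup y c xor false                           ≡⟨ Bool.xor-identityʳ _ ⟩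
    lookup y c                                     ≡⟨ lookup-merge-other i _ y c c∉i ⟨
    lookup (merge i (replicate n false) y) c       ∎
    where open ≡.≡-Reasoning

  module _ (x : Input n) where

    run : Vec Bool N → Input N
    run u = merge i x (y ⊕ zipWith _∧_ u s)

    -- Plays the part of a normalising factor. Multiplying by it, instead of dividing, avoids
    -- conditioning on transcripts of probability zero.
    mass : Constraints N → Carrier
    mass V = expect (uniform N) (λ u → indicator (satisfied V (run u)))

    module _ (V : Constraints N) (a : Vec Bool N) where

      mass-split : mass ((a , true) ∷ V) + mass ((a , false) ∷ V) ≈ mass V
      mass-split = trans (sym (expect-+ (uniform N) _ _))
        (expect-cong (uniform N) λ u → split ⟨ a , run u ⟩ (satisfied V (run u)))
        where
        split : ∀ b v → indicator (does (b Bool.≟ true) ∧ v) + indicator (does (b Bool.≟ false) ∧ v) ≈ indicator v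
        split true  v = +-identityʳ _
        split false v = +-identityˡ _

      mass-determined : ∀ b → (∀ u → Satisfies V (run u) → ⟨ a , run u ⟩ ≡ b) → mass ((a , not b) ∷ V) ≈ 0#
      mass-determined b determined = trans (expect-cong (uniform N) vanish) (expect-0 (uniform N))
        where
        vanish : ∀ u → indicator (does (⟨ a , run u ⟩ Bool.≟ not b) ∧ satisfied V (run u)) ≈ 0#
        vanish u with satisfied V (run u) in eq
        ... | false = reflexive (≡.cong indicator (Bool.∧-zeroʳ _))
        ... | true  rewrite determined u (satisfied⇒Satisfies V (run u) eq)
                          | dec-false (b Bool.≟ not b) (Bool.not-¬ ≡.refl) = refl

      -- The mask `s` and the planted block would discard part of a general translation; the support
      -- of `w` lies where neither does.
      run-⊕ : ∀ w → (∀ c → region i 0 S c ≡ false → lookup w c ≡ false) → ∀ u → run (u ⊕ w) ≡ run u ⊕ w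
      run-⊕ w w-off u = lookup-extensionality _ _ pointwise
        where
        y⊕ : ∀ u c → lookup (y ⊕ zipWith _∧_ u s) c ≡ lookup y c xor (lookup u c ∧ S c)
        y⊕ u c = ≡.trans (lookup-⊕ y _ c) (≡.cong (lookup y c xor_) (lookup-zipWith _∧_ c u s))
        pointwise : ∀ c → lookup (run (u ⊕ w)) c ≡ lookup (run u ⊕ w) c
        pointwise c with quotient n c Fin.≟ i | w-off c
        ... | yes c∈i | off = begin
          lookup (run (u ⊕ w)) c           ≡⟨ lookup-merge-own i x _ _ c c∈i ⟩
          lookup (run u) c                 ≡⟨ Bool.xor-identityʳ _ ⟨
          lookup (run u) c xor false       ≡⟨ ≡.cong (lookup (run u) c xor_) (off ≡.refl) ⟨
          lookup (run u) c xor lookup w c  ≡⟨ lookup-⊕ (run u) w c ⟨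
          lookup (run u ⊕ w) c             ∎
          where open ≡.≡-Reasoning
        ... | no c∉i | off = begin
          lookup (run (u ⊕ w)) c                                ≡⟨ lookup-merge-other i x _ c c∉i ⟩
          lookup (y ⊕ zipWith _∧_ (u ⊕ w) s) c                  ≡⟨ y⊕ (u ⊕ w) c ⟩
          lookup y c xor (lookup (u ⊕ w) c ∧ S c)               ≡⟨ ≡.cong (λ b → lookup y c xor (b ∧ S c)) (lookup-⊕ u w c) ⟩
          lookup y c xor ((lookup u c xor lookup w c) ∧ S c)    ≡⟨ ≡.cong (lookup y c xor_) (absorb (lookup u c) (lookup w c) (S c) off) ⟩
          lookup y c xor ((lookup u c ∧ S c) xor lookup w c)    ≡⟨ Bool.xor-assoc (lookup y c) _ _ ⟨
          (lookup y c xor (lookup u c ∧ S c)) xor lookup w c    ≡⟨ ≡.cong (_xor lookup w c) (y⊕ u c) ⟨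
          lookup (y ⊕ zipWith _∧_ u s) c xor lookup w c         ≡⟨ ≡.cong (_xor lookup w c) (lookup-merge-other i x _ c c∉i) ⟨
          lookup (run u) c xor lookup w c                       ≡⟨ lookup-⊕ (run u) w c ⟨
          lookup (run u ⊕ w) c                                  ∎
          where
          open ≡.≡-Reasoning
          absorb : ∀ u w s → (s ≡ false → w ≡ false) → (u xor w) ∧ s ≡ (u ∧ s) xor w
          absorb u w true  _    = ≡.trans (Bool.∧-identityʳ _) (≡.cong (_xor w) (≡.sym (Bool.∧-identityʳ u)))
          absorb u w false off  = ≡.trans (Bool.∧-zeroʳ (u xor w)) (≡.sym (≡.cong₂ _xor_ (Bool.∧-zeroʳ u) (off ≡.refl)))

      -- Translating the coins by `w` preserves their uniform law, keeps every recorded answer and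
      -- flips the answer to `a`, so the two outcomes are equally likely.
      mass-balanced : ∀ w → Separates V (region i 0 S) a w → mass ((a , true) ∷ V) ≈ mass ((a , false) ∷ V)
      mass-balanced w (w-off , V⊥w , aw) = trans
        (expect-cong (uniform N) λ u → reflexive (≡.cong indicator (≡.sym (flipped u))))
        (expect-uniform-⊕ w (λ u → indicator (satisfied ((a , false) ∷ V) (run u))))
        where
        unchanged : ∀ V → All (λ (g , _) → ⟨ g , w ⟩ ≡ false) V → ∀ z → satisfied V (z ⊕ w) ≡ satisfied V z
        unchanged []            []       z = ≡.refl
        unchanged ((g , b) ∷ V) (gw ∷ Vw) z = ≡.cong₂ _∧_ (≡.cong (λ r → does (r Bool.≟ b))
          (≡.trans (dot-⊕ʳ g z w) (≡.trans (≡.cong (⟨ g , z ⟩ xor_) gw) (Bool.xor-identityʳ ⟨ g , z ⟩)))) (unchanged V Vw z)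
        toggle : ∀ b → does ((b xor true) Bool.≟ false) ≡ does (b Bool.≟ true)
        toggle true  = ≡.refl
        toggle false = ≡.refl
        flipped : ∀ u → satisfied ((a , false) ∷ V) (run (u ⊕ w)) ≡ satisfied ((a , true) ∷ V) (run u)
        flipped u rewrite run-⊕ w w-off u = ≡.cong₂ _∧_
          (≡.trans (≡.cong (λ r → does (r Bool.≟ false)) (≡.trans (dot-⊕ʳ a (run u) w) (≡.cong (⟨ a , run u ⟩ xor_) aw)))
                   (toggle ⟨ a , run u ⟩))
          (unchanged V V⊥w (run u))

      mass-half : ∀ w → Separates V (region i 0 S) a w → ∀ b → mass ((a , b) ∷ V) ≈ ½ * mass V
      mass-half w sep b = trans (half b) (*-congˡ mass-split)
        where
        balanced = mass-balanced w sep
        half : ∀ b → mass ((a , b) ∷ V) ≈ ½ * (mass ((a , true) ∷ V) + mass ((a , false) ∷ V))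
        half true  = trans (sym (½*x+½*x≈x _)) (trans (+-congˡ (*-congˡ balanced)) (sym (distribˡ ½ _ _)))
        half false = trans (sym (½*x+½*x≈x _)) (trans (+-congʳ (*-congˡ (sym balanced))) (sym (distribˡ ½ _ _)))

      free-answer : ∀ (p : InSpan V (region i N S) a) → let v , β , _ = span⇒determined V p in
                    ∀ u → Satisfies V (run u) → ⟨ a , run u ⟩ ≡ β xor ⟨ v , merge i (replicate n false) y ⟩
      free-answer p u sat with v , β , v-off , det ← span⇒determined V p =
        ≡.trans (det (run u) sat) (≡.cong (β xor_) (dot-agree v _ _ agree))
        where
        agree : ∀ c → lookup v c ≡ true → lookup (run u) c ≡ lookup (merge i (replicate n false) y) c
        agree c vc with quotient n c Fin.≟ i | v-off c
        ... | yes _  | off with () ← ≡.trans (≡.sym vc) (off (<⇒<ᵇ (toℕ<n c)))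
        ... | no c∉i | off = frozen x u c c∉i (Bool.¬-not λ Sc → case ≡.trans (≡.sym vc) (off Sc) of λ ())

      -- Here `v` vanishes on the flagged bits of the other blocks but may meet block `i`, whence
      -- the additional term in `x`.
      charged-answer : ∀ (p : InSpan V (region i 0 S) a) → let v , β , _ = span⇒determined V p in
                       ∀ u → Satisfies V (run u) →
                       ⟨ a , run u ⟩ ≡ (β xor ⟨ v , merge i (replicate n false) y ⟩) xor ⟨ block i v , x ⟩
      charged-answer p u sat with v , β , v-off , det ← span⇒determined V p = begin
        ⟨ a , run u ⟩
          ≡⟨ det (run u) sat ⟩
        β xor ⟨ v , run u ⟩
          ≡⟨ ≡.cong (β xor_) (dot-merge i v x _) ⟩
        β xor (⟨ block i v , x ⟩ xor ⟨ v , merge i (replicate n false) (y ⊕ zipWith _∧_ u s) ⟩)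
          ≡⟨ ≡.cong (λ b → β xor (⟨ block i v , x ⟩ xor b)) (dot-agree v _ _ agree) ⟩
        β xor (⟨ block i v , x ⟩ xor ⟨ v , merge i (replicate n false) y ⟩)
          ≡⟨ ≡.cong (β xor_) (Bool.xor-comm ⟨ block i v , x ⟩ _) ⟩
        β xor (⟨ v , merge i (replicate n false) y ⟩ xor ⟨ block i v , x ⟩)
          ≡⟨ Bool.xor-assoc β _ _ ⟨
        (β xor ⟨ v , merge i (replicate n false) y ⟩) xor ⟨ block i v , x ⟩
          ∎
        where
        open ≡.≡-Reasoning
        agree : ∀ c → lookup v c ≡ true → lookup (merge i (replicate n false) (y ⊕ zipWith _∧_ u s)) c ≡
                                          lookup (merge i (replicate n false) y) c
        agree c vc with quotient n c Fin.≟ i | v-off c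
        ... | yes c∈i | _   = lookup-merge-own i _ _ y c c∈i
        ... | no c∉i  | off = frozen (replicate n false) u c c∉i (Bool.¬-not λ Sc → case ≡.trans (≡.sym vc) (off Sc) of λ ())

    value : Constraints N → PDT N k → (ℕ → Vec Bool 1 → Carrier) → Carrier
    value V t h = expect (simulate V t) (λ r → h (queries r x) (eval r x))

    module _ (V : Constraints N) (a : Vec Bool N) where

      -- The impossible branch has mass zero, so its value may be replaced by that of the possible
      -- one.
      mass-select : ∀ b → mass ((a , not b) ∷ V) ≈ 0# → ∀ A₁ A₀ →
                    mass ((a , true) ∷ V) * A₁ + mass ((a , false) ∷ V) * A₀ ≈ mass V * (if b then A₁ else A₀)
      mass-select true  mass≈0 A₁ A₀ = begin
        mass ((a , true) ∷ V) * A₁ + mass ((a , false) ∷ V) * A₀   ≈⟨ +-congˡ (*-congʳ mass≈0) ⟩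
        mass ((a , true) ∷ V) * A₁ + 0# * A₀                       ≈⟨ +-congˡ (trans (zeroˡ A₀) (sym (zeroˡ A₁))) ⟩
        mass ((a , true) ∷ V) * A₁ + 0# * A₁                       ≈⟨ +-congˡ (*-congʳ mass≈0) ⟨
        mass ((a , true) ∷ V) * A₁ + mass ((a , false) ∷ V) * A₁   ≈⟨ distribʳ A₁ _ _ ⟨
        (mass ((a , true) ∷ V) + mass ((a , false) ∷ V)) * A₁      ≈⟨ *-congʳ (mass-split V a) ⟩
        mass V * A₁                                                ∎
        where open ≈-Reasoning
      mass-select false mass≈0 A₁ A₀ = begin
        mass ((a , true) ∷ V) * A₁ + mass ((a , false) ∷ V) * A₀   ≈⟨ +-congʳ (*-congʳ mass≈0) ⟩
        0# * A₁ + mass ((a , false) ∷ V) * A₀                      ≈⟨ +-congʳ (trans (zeroˡ A₁) (sym (zeroˡ A₀))) ⟩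
        0# * A₀ + mass ((a , false) ∷ V) * A₀                      ≈⟨ +-congʳ (*-congʳ mass≈0) ⟨
        mass ((a , true) ∷ V) * A₀ + mass ((a , false) ∷ V) * A₀   ≈⟨ distribʳ A₀ _ _ ⟨
        (mass ((a , true) ∷ V) + mass ((a , false) ∷ V)) * A₀      ≈⟨ *-congʳ (mass-split V a) ⟩
        mass V * A₀                                                ∎
        where open ≈-Reasoning

    -- On `x` only one of the two subtrees is entered; the other is averaged out because its weights
    -- sum to 1.
    expect-node : ∀ (v : Vec Bool n) b₀ (D₁ D₀ : Dist (PDT n 1)) (h : ℕ → Vec Bool 1 → Carrier) → IsProbability D₁ → IsProbability D₀ →
      expect (D₁ >>= λ u₁ → D₀ >>= λ u₀ → return (if b₀ then node v u₁ u₀ else node v u₀ u₁))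
             (λ r → h (queries r x) (eval r x)) ≈
      (if b₀ xor ⟨ v , x ⟩ then expect D₁ (λ r → h (suc (queries r x)) (eval r x))
                           else expect D₀ (λ r → h (suc (queries r x)) (eval r x)))
    expect-node v b₀ D₁ D₀ h prob₁ prob₀ = begin
      expect (D₁ >>= λ u₁ → D₀ >>= λ u₀ → return (if b₀ then node v u₁ u₀ else node v u₀ u₁)) H
        ≈⟨ expect->>= D₁ _ H ⟩
      expect D₁ (λ u₁ → expect (D₀ >>= λ u₀ → return (if b₀ then node v u₁ u₀ else node v u₀ u₁)) H)
        ≈⟨ expect-cong D₁ (λ u₁ → trans (expect->>= D₀ _ H) (expect-cong D₀ λ u₀ →
             trans (expect-return (if b₀ then node v u₁ u₀ else node v u₀ u₁) H) (reflexive (select b₀ u₁ u₀)))) ⟩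
      expect D₁ (λ u₁ → expect D₀ (λ u₀ → if b₀ xor ⟨ v , x ⟩ then H′ u₁ else H′ u₀))
        ≈⟨ discard (b₀ xor ⟨ v , x ⟩) ⟩
      (if b₀ xor ⟨ v , x ⟩ then expect D₁ H′ else expect D₀ H′)
        ∎
      where
      open ≈-Reasoning
      H H′ : PDT n 1 → Carrier
      H  r = h (queries r x) (eval r x)
      H′ r = h (suc (queries r x)) (eval r x)
      select : ∀ b₀ u₁ u₀ → H (if b₀ then node v u₁ u₀ else node v u₀ u₁) ≡ (if b₀ xor ⟨ v , x ⟩ then H′ u₁ else H′ u₀)
      select true  u₁ u₀ with ⟨ v , x ⟩
      ... | true  = ≡.refl
      ... | false = ≡.refl
      select false u₁ u₀ with ⟨ v , x ⟩
      ... | true  = ≡.refl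
      ... | false = ≡.refl
      discard : ∀ b → expect D₁ (λ u₁ → expect D₀ (λ u₀ → if b then H′ u₁ else H′ u₀)) ≈
                      (if b then expect D₁ H′ else expect D₀ H′)
      discard true  = expect-cong D₁ λ u₁ → expect-const (H′ u₁) prob₀
      discard false = expect-const (expect D₀ H′) prob₁

    -- The three cases of `simulate`. A determined answer, charged or not, leaves one branch with
    -- mass zero; an undetermined one splits the mass in half, matching the toss. Only in the
    -- charged case does the simulation spend a query, which is what `h′` records.
    value-node : ∀ V a t₀ t₁ h → let h′ = λ q → h ((if charged S i V a then 1 else 0) ℕ.+ q) in
      mass ((a , true) ∷ V) * value ((a , true) ∷ V) t₁ h′ + mass ((a , false) ∷ V) * value ((a , false) ∷ V) t₀ h′ ≈
      mass V * value V (node a t₀ t₁) h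
    value-node V a t₀ t₁ h with inSpan? V (region i N S) a
    ... | yes p with v , β , _ ← span⇒determined V p | free ← free-answer V a p =
      trans (mass-select V a b (mass-determined V a b free) _ _) (*-congˡ (reflexive (push b)))
      where
      b = β xor ⟨ v , merge i (replicate n false) y ⟩
      push : ∀ b → (if b then value ((a , true) ∷ V) t₁ h else value ((a , false) ∷ V) t₀ h) ≡
             expect (if b then simulate ((a , true) ∷ V) t₁ else simulate ((a , false) ∷ V) t₀) (λ r → h (queries r x) (eval r x))
      push true  = ≡.refl
      push false = ≡.refl
    ... | no _ with inSpan? V (region i 0 S) a
    ...   | yes p with v , β , _ ← span⇒determined V p | ans ← charged-answer V a p =
      trans (mass-select V a b (mass-determined V a b ans) _ _)
        (*-congˡ (sym (expect-node (block i v) (β xor ⟨ v , merge i (replicate n false) y ⟩) _ _ h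
          (simulate-isProbability ((a , true) ∷ V) t₁) (simulate-isProbability ((a , false) ∷ V) t₀))))
      where
      b = (β xor ⟨ v , merge i (replicate n false) y ⟩) xor ⟨ block i v , x ⟩
    ...   | no ¬p with w , sep ← ¬span⇒separated V ¬p = begin
      mass ((a , true) ∷ V) * A₁ + mass ((a , false) ∷ V) * A₀
        ≈⟨ +-cong (*-congʳ (mass-half V a w sep true)) (*-congʳ (mass-half V a w sep false)) ⟩
      (½ * mass V) * A₁ + (½ * mass V) * A₀
        ≈⟨ +-cong (pull A₁) (pull A₀) ⟩
      mass V * (½ * A₁) + mass V * (½ * A₀)
        ≈⟨ distribˡ (mass V) _ _ ⟨
      mass V * (½ * A₁ + ½ * A₀)
        ≈⟨ *-congˡ (+-comm _ _) ⟩
      mass V * (½ * A₀ + ½ * A₁)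
        ≈⟨ *-congˡ (expect-fair (λ b → expect (f b) H)) ⟨
      mass V * expect fair (λ b → expect (f b) H)
        ≈⟨ *-congˡ (expect->>= fair f H) ⟨
      mass V * expect (fair >>= f) H
        ∎
      where
      open ≈-Reasoning
      f : Bool → Dist (PDT n 1)
      f b = if b then simulate ((a , true) ∷ V) t₁ else simulate ((a , false) ∷ V) t₀
      H : PDT n 1 → Carrier
      H r = h (queries r x) (eval r x)
      A₁ = value ((a , true) ∷ V) t₁ h
      A₀ = value ((a , false) ∷ V) t₀ h
      pull : ∀ z → (½ * mass V) * z ≈ mass V * (½ * z)
      pull z = trans (*-congʳ (*-comm ½ (mass V))) (*-assoc _ _ _)

    -- Taking an arbitrary `h` of the query count and the label lets one induction serve both cost
    -- and error. A branch restricts the coins to those that give the recorded answers, hence the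
    -- indicator and the mass; for empty `V` both are 1, and the simulation has the law of the true
    -- run with charges in place of queries.
    simulate-correct : ∀ V t h →
      expect (uniform N) (λ u → indicator (satisfied V (run u)) *
                                h (charges S i V t (run u)) (lookup (eval t (run u)) i ∷ [])) ≈
      mass V * value V t h
    simulate-correct V (leaf l) h = begin
      expect (uniform N) (λ u → indicator (satisfied V (run u)) * h 0 (lookup l i ∷ []))
        ≈⟨ expect-cong (uniform N) (λ u → *-comm _ _) ⟩
      expect (uniform N) (λ u → h 0 (lookup l i ∷ []) * indicator (satisfied V (run u)))
        ≈⟨ expect-*ˡ (uniform N) _ _ ⟩
      h 0 (lookup l i ∷ []) * mass V
        ≈⟨ *-comm _ _ ⟩
      mass V * h 0 (lookup l i ∷ [])
        ≈⟨ *-congˡ (expect-return (leaf (lookup l i ∷ [])) (λ r → h (queries r x) (eval r x))) ⟨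
      mass V * value V (leaf l) h
        ∎
      where open ≈-Reasoning
    simulate-correct V (node a t₀ t₁) h = begin
      expect (uniform N) (λ u → indicator (satisfied V (run u)) *
                                h (charges S i V (node a t₀ t₁) (run u)) (lookup (eval (node a t₀ t₁) (run u)) i ∷ []))
        ≈⟨ expect-cong (uniform N) (λ u → split ⟨ a , run u ⟩ (satisfied V (run u))
             (charges S i ((a , true) ∷ V) t₁ (run u)) (charges S i ((a , false) ∷ V) t₀ (run u))
             (eval t₁ (run u)) (eval t₀ (run u))) ⟩
      expect (uniform N) (λ u → term true t₁ u + term false t₀ u)
        ≈⟨ expect-+ (uniform N) (term true t₁) (term false t₀) ⟩
      expect (uniform N) (term true t₁) + expect (uniform N) (term false t₀)
        ≈⟨ +-cong (simulate-correct ((a , true) ∷ V) t₁ h′) (simulate-correct ((a , false) ∷ V) t₀ h′) ⟩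
      mass ((a , true) ∷ V) * value ((a , true) ∷ V) t₁ h′ + mass ((a , false) ∷ V) * value ((a , false) ∷ V) t₀ h′
        ≈⟨ value-node V a t₀ t₁ h ⟩
      mass V * value V (node a t₀ t₁) h
        ∎
      where
      open ≈-Reasoning
      charge = if charged S i V a then 1 else 0
      h′ : ℕ → Vec Bool 1 → Carrier
      h′ q = h (charge ℕ.+ q)
      term : Bool → PDT N k → Vec Bool N → Carrier
      term b t u = indicator (satisfied ((a , b) ∷ V) (run u)) *
                   h′ (charges S i ((a , b) ∷ V) t (run u)) (lookup (eval t (run u)) i ∷ [])
      split : ∀ b v q₁ q₀ (l₁ l₀ : Vec Bool k) →
        indicator v * h′ (if b then q₁ else q₀) (lookup (if b then l₁ else l₀) i ∷ []) ≈
        indicator (does (b Bool.≟ true) ∧ v) * h′ q₁ (lookup l₁ i ∷ []) +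
        indicator (does (b Bool.≟ false) ∧ v) * h′ q₀ (lookup l₀ i ∷ [])
      split true  v q₁ q₀ l₁ l₀ = sym (trans (+-congˡ (zeroˡ _)) (+-identityʳ _))
      split false v q₁ q₀ l₁ l₀ = sym (trans (+-congʳ (zeroˡ _)) (+-identityˡ _))

-- Average cost and error over symbols and blocks.

module Averaging {c ℓ₁ ℓ₂} (ℝ : Reals c ℓ₁ ℓ₂) where
  open RealProperties ℝ
  open Distributions ℝ

  expect-resample : ∀ {a b} {A : Set a} {B : Set b} (δ : B → Dist A) {n} (bs : Vec B n) →
    IsProbability (independent δ bs) → ∀ k (i : Fin k) F →
    expect (independent δ bs) (λ τ → expect (independent δ (concat (replicate k bs))) (λ σ → F (merge i τ σ))) ≈
    expect (independent δ (concat (replicate k bs))) F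
  expect-resample δ {n} bs prob (suc k) zero F = begin
    expect X (λ τ → expect (independent δ (bs ++ rs)) (λ σ → F (τ ++ drop n σ)))
      ≈⟨ expect-cong X (λ τ → expect-independent-++ δ bs rs (λ σ → F (τ ++ drop n σ))) ⟩
    expect X (λ τ → expect X (λ x → expect R (λ r → F (τ ++ drop n (x ++ r)))))
      ≈⟨ expect-cong X (λ τ → expect-cong X λ x → expect-cong R λ r →
           reflexive (≡.cong (λ r → F (τ ++ r)) (drop-++ x r))) ⟩
    expect X (λ τ → expect X (λ _ → expect R (λ r → F (τ ++ r))))
      ≈⟨ expect-cong X (λ τ → expect-const _ prob) ⟩
    expect X (λ τ → expect R (λ r → F (τ ++ r)))
      ≈⟨ expect-independent-++ δ bs rs F ⟨
    expect (independent δ (bs ++ rs)) F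
      ∎
    where
    open ≈-Reasoning
    rs = concat (replicate k bs)
    X = independent δ bs
    R = independent δ rs
  expect-resample δ {n} bs prob (suc k) (suc i) F = begin
    expect X (λ τ → expect (independent δ (bs ++ rs)) (λ σ → F (take n σ ++ merge i τ (drop n σ))))
      ≈⟨ expect-cong X (λ τ → expect-independent-++ δ bs rs (λ σ → F (take n σ ++ merge i τ (drop n σ)))) ⟩
    expect X (λ τ → expect X (λ x → expect R (λ r → F (take n (x ++ r) ++ merge i τ (drop n (x ++ r))))))
      ≈⟨ expect-cong X (λ τ → expect-cong X λ x → expect-cong R λ r →
           reflexive (≡.cong₂ (λ x r → F (x ++ merge i τ r)) (take-++ x r) (drop-++ x r))) ⟩
    expect X (λ τ → expect X (λ x → expect R (λ r → F (x ++ merge i τ r))))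
      ≈⟨ expect-comm X X _ ⟩
    expect X (λ x → expect X (λ τ → expect R (λ r → F (x ++ merge i τ r))))
      ≈⟨ expect-cong X (λ x → expect-resample δ bs prob k i (λ r → F (x ++ r))) ⟩
    expect X (λ x → expect R (λ r → F (x ++ r)))
      ≈⟨ expect-independent-++ δ bs rs F ⟨
    expect (independent δ (bs ++ rs)) F
      ∎
    where
    open ≈-Reasoning
    rs = concat (replicate k bs)
    X = independent δ bs
    R = independent δ rs

  fromℕ : ℕ → Carrier
  fromℕ q = q · 1#

  0≤fromℕ : ∀ q → 0# ≤ fromℕ q
  0≤fromℕ zero    = ≤-refl
  0≤fromℕ (suc q) = 0≤x+y (<⇒≤ 0<1) (0≤fromℕ q)

  fromℕ-mono : ∀ {p q} → p ℕ.≤ q → fromℕ p ≤ fromℕ q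
  fromℕ-mono {q = q} z≤n = 0≤fromℕ q
  fromℕ-mono (s≤s p≤q) = +-monoʳ-≤ 1# (fromℕ-mono p≤q)

  fromℕ-count : ∀ {N} (f : Fin N → Bool) → fromℕ (count f) ≈ sum (indicator ∘ f)
  fromℕ-count {zero}  f = refl
  fromℕ-count {suc N} f with f zero
  ... | true  = +-congˡ (fromℕ-count (f ∘ suc))
  ... | false = trans (fromℕ-count (f ∘ suc)) (sym (+-identityˡ _))

  sum-cong : ∀ {N} (f g : Fin N → Carrier) → (∀ c → f c ≈ g c) → sum f ≈ sum g
  sum-cong {zero}  f g f≈g = refl
  sum-cong {suc N} f g f≈g = +-cong (f≈g zero) (sum-cong (f ∘ suc) (g ∘ suc) (f≈g ∘ suc))

  sum-zero : ∀ {N} (f : Fin N → Carrier) → (∀ c → f c ≈ 0#) → sum f ≈ 0#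
  sum-zero {zero}  f f≈0 = refl
  sum-zero {suc N} f f≈0 = trans (+-cong (f≈0 zero) (sum-zero (f ∘ suc) (f≈0 ∘ suc))) (+-identityˡ 0#)

  sum-select : ∀ {k} (j : Fin k) b → sum (λ i → indicator (does (j Fin.≟ i) ∧ b)) ≈ indicator b
  sum-select {suc k} zero b = trans (+-congˡ (sum-zero {k} (λ _ → 0#) (λ _ → refl))) (+-identityʳ _)
  sum-select {suc k} (suc j) b = trans (+-identityˡ _) (sum-select j b)

  sum-mono : ∀ {N} (f g : Fin N → Carrier) → (∀ c → f c ≤ g c) → sum f ≤ sum g
  sum-mono {zero}  f g f≤g = ≤-refl
  sum-mono {suc N} f g f≤g = +-mono-≤ (f≤g zero) (sum-mono (f ∘ suc) (g ∘ suc) (f≤g ∘ suc))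

  indicator-∧ : ∀ a b → indicator a * indicator b ≈ indicator (a ∧ b)
  indicator-∧ true  b = *-identityˡ _
  indicator-∧ false b = zeroˡ _

  indicator-not-mono : ∀ {p q} {P : Set p} {Q : Set q} (P? : Dec P) (Q? : Dec Q) → (Q → P) →
                       indicator (not (does P?)) ≤ indicator (not (does Q?))
  indicator-not-mono (yes _) Q?      _   = 0≤indicator (not (does Q?))
  indicator-not-mono (no ¬p) (yes q) Q⇒P = contradiction (Q⇒P q) ¬p
  indicator-not-mono (no _)  (no _)  _   = ≤-refl

  module Extraction (h : Carrier) (0≤h : 0# ≤ h) {n} (ps : Vec Carrier n)
                    (admissible : VecAll.All (Flagged.Admissible h 0≤h) ps) (k : ℕ) where
    open Flagged h 0≤h
    open Pivots {k ℕ.* n} {k} (quotient n)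

    N : ℕ
    N = k ℕ.* n

    qs : Vec Carrier N
    qs = concat (replicate k ps)

    qs-admissible : VecAll.All Admissible qs
    qs-admissible = VecAll.concat⁺ (all-replicate k)
      where
      all-replicate : ∀ k → VecAll.All (VecAll.All Admissible) (replicate k ps)
      all-replicate zero    = VecAll.[]
      all-replicate (suc k) = admissible VecAll.∷ all-replicate k

    inputs : Dist (Input n)
    inputs = independent coin ps

    inputs-nonNegative : NonNegativeWeights inputs
    inputs-nonNegative = proj₁ (independent-isProbability coin (VecAll.map coin-prob admissible))
      where
      coin-prob : ∀ {p} → Admissible p → IsProbability (coin p)
      coin-prob (h≤p , p≤1-h) = coin-isProbability (≤-trans 0≤h h≤p)
        (≤-trans p≤1-h (≤-trans (x≤x+y 0≤h) (≤-reflexive (x-y+y≈x 1# h))))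

    symbols-prob : IsProbability (symbols qs)
    symbols-prob = symbols-isProbability qs-admissible

    simulation : Fin k → Vec Symbol N → PDT N k → Dist (PDT n 1)
    simulation i σ = Simulation.simulate ℝ {k} {n} i (flags σ) (bits σ) []

    -- The simulation does not look at the flagged bits of `σ`, so the true run may be averaged over
    -- a re-tossing of them, and re-tossing leaves the law of `σ` unchanged.
    expect-simulation : ∀ i t (g : Input n → ℕ → Vec Bool 1 → Carrier) →
      expect (symbols qs) (λ σ → expect (simulation i σ t) (λ r → expect inputs (λ x → g x (queries r x) (eval r x)))) ≈
      expect inputs (λ x → expect (symbols qs) (λ σ →
        g x (charges (lookup (flags σ)) i [] t (merge i x (bits σ))) (lookup (eval t (merge i x (bits σ))) i ∷ [])))
    expect-simulation i t g = begin
      expect (symbols qs) (λ σ → expect (simulation i σ t) (λ r → expect inputs (λ x → g x (queries r x) (eval r x))))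
        ≈⟨ expect-cong (symbols qs) (λ σ → expect-comm (simulation i σ t) inputs (λ r x → g x (queries r x) (eval r x))) ⟩
      expect (symbols qs) (λ σ → expect inputs (λ x → Value σ x))
        ≈⟨ expect-comm (symbols qs) inputs Value ⟩
      expect inputs (λ x → expect (symbols qs) (λ σ → Value σ x))
        ≈⟨ expect-cong inputs (λ x → trans (expect-cong (symbols qs) (λ σ → unfold σ x)) (expect-refresh qs (K x))) ⟩
      expect inputs (λ x → expect (symbols qs) (K x))
        ∎
      where
      open ≈-Reasoning
      Value : Vec Symbol N → Input n → Carrier
      Value σ x = expect (simulation i σ t) (λ r → g x (queries r x) (eval r x))
      K′ : Input n → Vec Bool N → Input N → Carrier
      K′ x s y = g x (charges (lookup s) i [] t (merge i x y)) (lookup (eval t (merge i x y)) i ∷ [])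
      K : Input n → Vec Symbol N → Carrier
      K x σ = K′ x (flags σ) (bits σ)
      unfold : ∀ σ x → Value σ x ≈ expect (uniform N) (λ u → K x (zipWith refresh σ u))
      unfold σ x = begin
        Value σ x
          ≈⟨ *-identityˡ _ ⟨
        1# * Value σ x
          -- The inserted factor is the mass of the empty list of constraints.
          ≈⟨ *-congʳ (expect-const 1# (uniform-isProbability N)) ⟨
        expect (uniform N) (λ _ → 1#) * Value σ x
          ≈⟨ Simulation.simulate-correct ℝ {k} {n} i (flags σ) (bits σ) x [] t (g x) ⟨
        expect (uniform N) (λ u → 1# * K′ x (flags σ) (bits σ ⊕ zipWith _∧_ u (flags σ)))
          ≈⟨ expect-cong (uniform N) (λ u → trans (*-identityˡ _)
               (reflexive (≡.cong₂ (K′ x) (≡.sym (flags-refresh σ u)) (≡.sym (bits-refresh σ u))))) ⟩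
        expect (uniform N) (λ u → K x (zipWith refresh σ u))
          ∎

    -- Block i of bits σ is itself a fresh input, and F ignores the flags of that block.
    expect-plant : ∀ i (F : Vec Bool N → Input N → Carrier) →
      (∀ s s′ z → (∀ c → quotient n c ≢ i → lookup s c ≡ lookup s′ c) → F s z ≈ F s′ z) →
      expect inputs (λ x → expect (symbols qs) (λ σ → F (flags σ) (merge i x (bits σ)))) ≈
      expect (symbols qs) (λ σ → F (flags σ) (bits σ))
    expect-plant i F local = begin
      expect inputs (λ x → expect (symbols qs) (λ σ → F (flags σ) (merge i x (bits σ))))
        ≈⟨ expect-symbols-bits ps (λ x → expect (symbols qs) (λ σ → F (flags σ) (merge i x (bits σ)))) ⟨
      expect (symbols ps) (λ τ → expect (symbols qs) (λ σ → F (flags σ) (merge i (bits τ) (bits σ))))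
        ≈⟨ expect-cong (symbols ps) (λ τ → expect-cong (symbols qs) (λ σ → planted τ σ)) ⟩
      expect (symbols ps) (λ τ → expect (symbols qs) (λ σ → F (flags (merge i τ σ)) (bits (merge i τ σ))))
        ≈⟨ expect-resample symbol ps (symbols-isProbability admissible) k i (λ σ → F (flags σ) (bits σ)) ⟩
      expect (symbols qs) (λ σ → F (flags σ) (bits σ))
        ∎
      where
      open ≈-Reasoning
      planted : ∀ τ σ → F (flags σ) (merge i (bits τ) (bits σ)) ≈ F (flags (merge i τ σ)) (bits (merge i τ σ))
      planted τ σ = trans
        (local _ _ _ λ c c∉i → ≡.trans (≡.sym (lookup-merge-other i (flags τ) (flags σ) c c∉i))
          (≡.cong (λ s → lookup s c) (≡.sym (map-merge proj₁ i τ σ))))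
        (reflexive (≡.cong (F (flags (merge i τ σ))) (≡.sym (map-merge proj₂ i τ σ))))

    module _ (t : PDT N k) where

      leadCount : Fin k → Vec Bool N → Input N → Carrier
      leadCount i s z = fromℕ (count (leads (transcript [] t z) (lookup s) i))

      leadAt : Fin N → Vec Bool N → Input N → Bool
      leadAt c s z = does (lead? (transcript [] t z) (lookup s) c)

      leadCount-local : ∀ i s s′ z → (∀ c → quotient n c ≢ i → lookup s c ≡ lookup s′ c) →
                        leadCount i s z ≈ leadCount i s′ z
      leadCount-local i s s′ z same = trans (fromℕ-count (leads (transcript [] t z) (lookup s) i))
        (trans (sum-cong (λ c → indicator (leads (transcript [] t z) (lookup s) i c)) (λ c → indicator (leads (transcript [] t z) (lookup s′) i c)) (λ c → reflexive (≡.cong indicator (agree c)))) (sym (fromℕ-count (leads (transcript [] t z) (lookup s′) i))))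
        where
        agree : ∀ c → leads (transcript [] t z) (lookup s) i c ≡ leads (transcript [] t z) (lookup s′) i c
        agree c with quotient n c Fin.≟ i
        ... | no _       = ≡.refl
        ... | yes ≡.refl = lead-local (transcript [] t z) (lookup s) (lookup s′) c same

      sum-leadCount : ∀ s z → sum {k} (λ i → leadCount i s z) ≈ sum {N} (λ c → indicator (leadAt c s z))
      sum-leadCount s z = begin
        sum {k} (λ i → leadCount i s z)
          ≈⟨ sum-cong (λ i → leadCount i s z) (λ i → sum {N} (λ c → indicator (leads (transcript [] t z) (lookup s) i c))) (λ i → fromℕ-count (leads (transcript [] t z) (lookup s) i)) ⟩
        sum {k} (λ i → sum {N} (λ c → indicator (does (quotient n c Fin.≟ i) ∧ leadAt c s z)))
          ≈⟨ ∑-comm {k} {N} (λ i c → indicator (does (quotient n c Fin.≟ i) ∧ leadAt c s z)) ⟩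
        sum {N} (λ c → sum {k} (λ i → indicator (does (quotient n c Fin.≟ i) ∧ leadAt c s z)))
          ≈⟨ sum-cong (λ c → sum {k} (λ i → indicator (does (quotient n c Fin.≟ i) ∧ leadAt c s z))) (λ c → indicator (leadAt c s z)) (λ c → sum-select {k} (quotient n c) (leadAt c s z)) ⟩
        sum {N} (λ c → indicator (leadAt c s z))
          ∎
        where open ≈-Reasoning

      -- Whether `c` leads is settled by all the bits and the flags of the other blocks. The bits
      -- include that of `c` itself, which may be correlated with its flag, so the flag needs a
      -- lower bound on its probability for each value of the bit.
      flagged-leadAt : ∀ c → h * expect (symbols qs) (λ σ → indicator (leadAt c (flags σ) (bits σ))) ≤
                             expect (symbols qs) (λ σ → indicator (lookup (flags σ) c ∧ leadAt c (flags σ) (bits σ)))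
      flagged-leadAt c = ≤-trans
        (flagged-symbols qs-admissible c _ (λ σ → 0≤indicator (leadAt c (flags σ) (bits σ))) invariant)
        (≤-reflexive (expect-cong (symbols qs) (λ σ → indicator-∧ (lookup (flags σ) c) (leadAt c (flags σ) (bits σ)))))
        where
        same-bits : ∀ {N} (σ : Vec Symbol N) c f → bits (σ [ c ]%= setFlag f) ≡ bits σ
        same-bits (s ∷ σ) zero    f = ≡.refl
        same-bits (s ∷ σ) (suc c) f = ≡.cong (proj₂ s ∷_) (same-bits σ c f)
        invariant : ∀ σ f → indicator (leadAt c (flags (σ [ c ]%= setFlag f)) (bits (σ [ c ]%= setFlag f))) ≈
                            indicator (leadAt c (flags σ) (bits σ))
        invariant σ f = reflexive (≡.cong indicator (≡.trans
          (≡.cong (leadAt c (flags (σ [ c ]%= setFlag f))) (same-bits σ c f))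
          (lead-local (transcript [] t (bits σ)) _ _ c λ c′ c′≁c → begin
            lookup (flags (σ [ c ]%= setFlag f)) c′    ≡⟨ lookup-map c′ proj₁ (σ [ c ]%= setFlag f) ⟩
            proj₁ (lookup (σ [ c ]%= setFlag f) c′)    ≡⟨ ≡.cong proj₁ (lookup∘updateAt′ c′ c (λ { ≡.refl → c′≁c ≡.refl }) σ) ⟩
            proj₁ (lookup σ c′)                        ≡⟨ lookup-map c′ proj₁ σ ⟨
            lookup (flags σ) c′                        ∎)))
          where open ≡.≡-Reasoning

      flagged-leads : ∀ σ → sum {N} (λ c → indicator (lookup (flags σ) c ∧ leadAt c (flags σ) (bits σ))) ≤ fromℕ (queries t (bits σ))
      flagged-leads σ = begin
        sum {N} (λ c → indicator (lookup (flags σ) c ∧ leadAt c (flags σ) (bits σ)))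
          ≈⟨ fromℕ-count (λ c → lookup (flags σ) c ∧ leadAt c (flags σ) (bits σ)) ⟨
        fromℕ (count (λ c → lookup (flags σ) c ∧ leadAt c (flags σ) (bits σ)))
          ≲⟨ fromℕ-mono (count-lead (lookup (flags σ)) (transcript [] t (bits σ))) ⟩
        fromℕ (length (transcript [] t (bits σ)))
          ≈⟨ reflexive (≡.cong fromℕ (≡.trans (length-transcript [] t (bits σ)) (ℕ.+-identityʳ _))) ⟩
        fromℕ (queries t (bits σ))
          ∎
        where open ≤-Reasoning

      simulationCost : Fin k → Carrier
      simulationCost i = expect (symbols qs) (λ σ → expect (simulation i σ t) (λ r → expect inputs (λ x → fromℕ (queries r x))))

      -- Charges of the planted run are bounded by the leading coordinates of its transcript. As
      -- these ignore the flags of block `i`, the planted input and the other blocks may be read off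
      -- a single sample of symbols.
      simulationCost≤ : ∀ i → simulationCost i ≤ expect (symbols qs) (λ σ → leadCount i (flags σ) (bits σ))
      simulationCost≤ i = begin
        simulationCost i
          ≈⟨ expect-simulation i t (λ x q _ → fromℕ q) ⟩
        expect inputs (λ x → expect (symbols qs) (λ σ → fromℕ (charges (lookup (flags σ)) i [] t (merge i x (bits σ)))))
          ≲⟨ expect-mono inputs-nonNegative (λ x → expect-mono (proj₁ symbols-prob) (λ σ → fromℕ-mono
               {charges (lookup (flags σ)) i [] t (merge i x (bits σ))}
               (ℕ.≤-trans (ℕ.m≤m+n _ (count (leads [] (lookup (flags σ)) i))) (charges-leads (lookup (flags σ)) i [] t (merge i x (bits σ)))))) ⟩
        expect inputs (λ x → expect (symbols qs) (λ σ → leadCount i (flags σ) (merge i x (bits σ))))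
          ≈⟨ expect-plant i (leadCount i) (leadCount-local i) ⟩
        expect (symbols qs) (λ σ → leadCount i (flags σ) (bits σ))
          ∎
        where open ≤-Reasoning

      total-simulationCost : h * sum {k} simulationCost ≤ expect (independent coin qs) (λ z → fromℕ (queries t z))
      total-simulationCost = begin
        h * sum {k} simulationCost
          ≲⟨ *-monoʳ-≤ 0≤h (sum-mono simulationCost (λ i → expect (symbols qs) (λ σ → leadCount i (flags σ) (bits σ))) simulationCost≤) ⟩
        h * sum {k} (λ i → expect (symbols qs) (λ σ → leadCount i (flags σ) (bits σ)))
          ≈⟨ *-congˡ (expect-sum (symbols qs) (λ i σ → leadCount i (flags σ) (bits σ))) ⟨
        h * expect (symbols qs) (λ σ → sum {k} (λ i → leadCount i (flags σ) (bits σ)))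
          ≈⟨ *-congˡ (expect-cong (symbols qs) (λ σ → sum-leadCount (flags σ) (bits σ))) ⟩
        h * expect (symbols qs) (λ σ → sum {N} (λ c → indicator (leadAt c (flags σ) (bits σ))))
          ≈⟨ *-congˡ (expect-sum (symbols qs) (λ c σ → indicator (leadAt c (flags σ) (bits σ)))) ⟩
        h * sum {N} (λ c → expect (symbols qs) (λ σ → indicator (leadAt c (flags σ) (bits σ))))
          ≈⟨ *-distribˡ-sum {N} h (λ c → expect (symbols qs) (λ σ → indicator (leadAt c (flags σ) (bits σ)))) ⟩
        sum {N} (λ c → h * expect (symbols qs) (λ σ → indicator (leadAt c (flags σ) (bits σ))))
          -- The factor `h` pays for the restriction to flagged coordinates, the ones that the
          -- dimension count covers.
          ≲⟨ sum-mono (λ c → h * expect (symbols qs) (λ σ → indicator (leadAt c (flags σ) (bits σ)))) (λ c → expect (symbols qs) (λ σ → indicator (lookup (flags σ) c ∧ leadAt c (flags σ) (bits σ)))) flagged-leadAt ⟩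
        sum {N} (λ c → expect (symbols qs) (λ σ → indicator (lookup (flags σ) c ∧ leadAt c (flags σ) (bits σ))))
          ≈⟨ expect-sum (symbols qs) (λ c σ → indicator (lookup (flags σ) c ∧ leadAt c (flags σ) (bits σ))) ⟨
        expect (symbols qs) (λ σ → sum {N} (λ c → indicator (lookup (flags σ) c ∧ leadAt c (flags σ) (bits σ))))
          ≲⟨ expect-mono (proj₁ symbols-prob) flagged-leads ⟩
        expect (symbols qs) (λ σ → fromℕ (queries t (bits σ)))
          ≈⟨ expect-symbols-bits qs (λ z → fromℕ (queries t z)) ⟩
        expect (independent coin qs) (λ z → fromℕ (queries t z))
          ∎
        where open ≤-Reasoning

      -- A wrong label for block `i` already makes the whole output wrong, and the planted run has
      -- the law of an ordinary one; so no choice of `i` increases the error.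
      simulationError : ∀ (f : Input n → Bool) i →
        expect (symbols qs) (λ σ → expect (simulation i σ t) (λ r → expect inputs (λ x →
          indicator (not (does (≡-dec Bool._≟_ (eval r x) (single f x))))))) ≤
        expect (independent coin qs) (λ z → indicator (not (does (≡-dec Bool._≟_ (eval t z) (power k f z)))))
      simulationError f i = begin
        expect (symbols qs) (λ σ → expect (simulation i σ t) (λ r → expect inputs (λ x → wrong (eval r x) (single f x))))
          ≈⟨ expect-simulation i t (λ x _ l → wrong l (single f x)) ⟩
        expect inputs (λ x → expect (symbols qs) (λ σ → wrong (lookup (eval t (merge i x (bits σ))) i ∷ []) (single f x)))
          ≲⟨ expect-mono inputs-nonNegative (λ x → expect-mono (proj₁ symbols-prob) (λ σ → some-block x (bits σ))) ⟩
        expect inputs (λ x → expect (symbols qs) (λ σ → wrong (eval t (merge i x (bits σ))) (power k f (merge i x (bits σ)))))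
          ≈⟨ expect-plant i (λ _ z → wrong (eval t z) (power k f z)) (λ _ _ _ _ → refl) ⟩
        expect (symbols qs) (λ σ → wrong (eval t (bits σ)) (power k f (bits σ)))
          ≈⟨ expect-symbols-bits qs (λ z → wrong (eval t z) (power k f z)) ⟩
        expect (independent coin qs) (λ z → wrong (eval t z) (power k f z))
          ∎
        where
        open ≤-Reasoning
        wrong : ∀ {m} → Vec Bool m → Vec Bool m → Carrier
        wrong l l′ = indicator (not (does (≡-dec Bool._≟_ l l′)))
        some-block : ∀ x y → wrong (lookup (eval t (merge i x y)) i ∷ []) (single f x) ≤
                             wrong (eval t (merge i x y)) (power k f (merge i x y))
        some-block x y = indicator-not-mono
          (≡-dec Bool._≟_ (lookup (eval t (merge i x y)) i ∷ []) (single f x))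
          (≡-dec Bool._≟_ (eval t (merge i x y)) (power k f (merge i x y))) λ correct →
          ≡.cong (_∷ []) (≡.trans (≡.cong (λ l → lookup l i) correct)
            (≡.trans (lookup-map i f (blocks k (merge i x y))) (≡.cong f (block-merge i x y))))

-- From product weights to randomised trees.

module DirectSum {c ℓ₁ ℓ₂} (ℝ : Reals c ℓ₁ ℓ₂) where
  open RealProperties ℝ
  open Distributions ℝ
  open Averaging ℝ
  open Average ℝ

  ∑-cong : ∀ {N} {F G : Input N → Carrier} → (∀ x → F x ≈ G x) → ∑ F ≈ ∑ G
  ∑-cong {zero}  F≈G = F≈G []
  ∑-cong {suc N} F≈G = +-cong (∑-cong (F≈G ∘ (false ∷_))) (∑-cong (F≈G ∘ (true ∷_)))

  ∑-*ˡ : ∀ {N} q (F : Input N → Carrier) → ∑ (λ x → q * F x) ≈ q * ∑ F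
  ∑-*ˡ {zero}  q F = refl
  ∑-*ˡ {suc N} q F = trans (+-cong (∑-*ˡ q (F ∘ (false ∷_))) (∑-*ˡ q (F ∘ (true ∷_)))) (sym (distribˡ q _ _))

  ∑-++ : ∀ {M N} (F : Input (M ℕ.+ N) → Carrier) → ∑ F ≈ ∑ {M} (λ x → ∑ {N} (λ y → F (x ++ y)))
  ∑-++ {zero}  F = refl
  ∑-++ {suc M} F = +-cong (∑-++ {M} (F ∘ (false ∷_))) (∑-++ {M} (F ∘ (true ∷_)))

  ∑-product : ∀ {n} (p : Fin n → Carrier) F →
    ∑ (λ x → product {n} (λ i → bernoulli (p i) (lookup x i)) * F x) ≈ expect (independent coin (tabulate p)) F
  ∑-product {zero}  p F = trans (*-identityˡ _) (sym (expect-return [] F))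
  ∑-product {suc n} p F = begin
    half false + half true
      ≈⟨ +-cong (factor false) (factor true) ⟩
    (1# - p zero) * rest false + p zero * rest true
      ≈⟨ +-congˡ (+-identityʳ _) ⟨
    expect (coin (p zero)) rest
      ≈⟨ expect-∷ coin (p zero) (tabulate (p ∘ suc)) F ⟨
    expect (independent coin (tabulate p)) F
      ∎
    where
    open ≈-Reasoning
    weight : Vec Bool n → Carrier
    weight x = product {n} (λ i → bernoulli (p (suc i)) (lookup x i))
    half rest : Bool → Carrier
    half b = ∑ (λ x → (bernoulli (p zero) b * weight x) * F (b ∷ x))
    rest b = expect (independent coin (tabulate (p ∘ suc))) (F ∘ (b ∷_))
    factor : ∀ b → half b ≈ bernoulli (p zero) b * rest b
    factor b = trans (∑-cong (λ x → *-assoc (bernoulli (p zero) b) (weight x) (F (b ∷ x))))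
      (trans (∑-*ˡ (bernoulli (p zero) b) (λ x → weight x * F (b ∷ x))) (*-congˡ (∑-product (p ∘ suc) (F ∘ (b ∷_)))))

  expect-bit : ∀ {n} {ps : Vec Carrier n} → VecAll.All (IsProbability ∘ coin) ps → ∀ i →
               expect (independent coin ps) (λ x → indicator (lookup x i)) ≈ lookup ps i
  expect-bit {ps = p ∷ ps} (_ VecAll.∷ probs) zero = begin
    expect (independent coin (p ∷ ps)) (λ x → indicator (lookup x zero))
      ≈⟨ expect-∷ coin p ps _ ⟩
    expect (coin p) (λ b → expect (independent coin ps) (λ _ → indicator b))
      ≈⟨ expect-cong (coin p) (λ b → expect-const (indicator b) (independent-isProbability coin probs)) ⟩
    (1# - p) * 0# + (p * 1# + 0#)
      ≈⟨ +-cong (zeroʳ _) (trans (+-identityʳ _) (*-identityʳ p)) ⟩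
    0# + p
      ≈⟨ +-identityˡ p ⟩
    p ∎
    where open ≈-Reasoning
  expect-bit {ps = p ∷ ps} (prob VecAll.∷ probs) (suc i) = begin
    expect (independent coin (p ∷ ps)) (λ x → indicator (lookup x (suc i)))
      ≈⟨ expect-∷ coin p ps _ ⟩
    expect (coin p) (λ _ → expect (independent coin ps) (λ x → indicator (lookup x i)))
      ≈⟨ expect-const _ prob ⟩
    expect (independent coin ps) (λ x → indicator (lookup x i))
      ≈⟨ expect-bit probs i ⟩
    lookup ps i ∎
    where open ≈-Reasoning

  module _ {n} (μ : Weight n) (p : Fin n → Carrier)
           (μ≈ : ∀ x → μ x ≈ product {n} (λ i → bernoulli (p i) (lookup x i))) where

    𝔼-product : ∀ F → 𝔼 μ F ≈ expect (independent coin (tabulate p)) F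
    𝔼-product F = trans (∑-cong (λ x → *-congʳ (μ≈ x))) (∑-product p F)

    𝔼-powerWeight : ∀ k F → 𝔼 (powerWeight k μ) F ≈ expect (independent coin (concat (replicate k (tabulate p)))) F
    𝔼-powerWeight zero    F = trans (*-identityˡ _) (sym (expect-return [] F))
    𝔼-powerWeight (suc k) F = begin
      ∑ {suc k ℕ.* n} (λ z → powerWeight (suc k) μ z * F z)
        ≈⟨ ∑-++ {n} {k ℕ.* n} (λ z → powerWeight (suc k) μ z * F z) ⟩
      ∑ {n} (λ x → ∑ {k ℕ.* n} (λ r → powerWeight (suc k) μ (x ++ r) * F (x ++ r)))
        ≈⟨ ∑-cong {n} factor ⟩
      𝔼 μ (λ x → 𝔼 (powerWeight k μ) (λ r → F (x ++ r)))
        ≈⟨ 𝔼-product (λ x → 𝔼 (powerWeight k μ) (λ r → F (x ++ r))) ⟩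
      expect (independent coin (tabulate p)) (λ x → 𝔼 (powerWeight k μ) (λ r → F (x ++ r)))
        ≈⟨ expect-cong (independent coin (tabulate p)) (λ x → 𝔼-powerWeight k (λ r → F (x ++ r))) ⟩
      expect (independent coin (tabulate p)) (λ x → expect (independent coin (concat (replicate k (tabulate p)))) (λ r → F (x ++ r)))
        ≈⟨ expect-independent-++ coin (tabulate p) _ F ⟨
      expect (independent coin (concat (replicate (suc k) (tabulate p)))) F
        ∎
      where
      open ≈-Reasoning
      powerWeight-++ : ∀ x r → powerWeight (suc k) μ (x ++ r) ≈ μ x * powerWeight k μ r
      powerWeight-++ x r = reflexive (≡.cong (λ bs → product {suc k} (λ j → μ (lookup bs j))) (blocks-++ k x r))

      factor : ∀ x → ∑ {k ℕ.* n} (λ r → powerWeight (suc k) μ (x ++ r) * F (x ++ r)) ≈ μ x * 𝔼 (powerWeight k μ) (λ r → F (x ++ r))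
      factor x = trans (∑-cong {k ℕ.* n} {λ r → powerWeight (suc k) μ (x ++ r) * F (x ++ r)}
                                         {λ r → μ x * (powerWeight k μ r * F (x ++ r))}
                                         (λ r → trans (*-congʳ (powerWeight-++ x r)) (*-assoc (μ x) _ _)))
                       (∑-*ˡ {k ℕ.* n} (μ x) (λ r → powerWeight k μ r * F (x ++ r)))

    -- `IsBounded` constrains the marginals of `μ`; this identifies them with the Bernoulli
    -- parameters, of which admissibility speaks.
    bias : (∀ i → 0# ≤ p i × p i ≤ 1#) → ∀ i → Pr μ (λ x → lookup x i) ≈ p i
    bias bounds i = trans (𝔼-product _) (trans
      (expect-bit (VecAll.tabulate⁺ {P = IsProbability ∘ coin} (λ i → coin-isProbability (proj₁ (bounds i)) (proj₂ (bounds i)))) i)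
      (reflexive (lookup∘tabulate p i)))

  equally : ∀ {a} {A : Set a} → Carrier → ∀ {k} → (Fin k → A) → Dist A
  equally w g = List.tabulate (λ i → w , g i)

  expect-equally : ∀ {a} {A : Set a} w {k} (g : Fin k → A) F → expect (equally w g) F ≈ w * sum {k} (λ i → F (g i))
  expect-equally w {zero}  g F = sym (zeroʳ w)
  expect-equally w {suc k} g F = trans (+-congˡ (expect-equally w (g ∘ suc) F)) (sym (distribˡ w _ _))

  sum-1 : ∀ k → sum {k} (λ _ → 1#) ≈ fromℕ k
  sum-1 zero    = refl
  sum-1 (suc k) = +-congˡ (sum-1 k)

  equally-isProbability : ∀ {a} {A : Set a} {w k} → 0# ≤ w → w * fromℕ k ≈ 1# → (g : Fin k → A) → IsProbability (equally w g)
  equally-isProbability {w = w} {k} 0≤w wk≈1 g = All.tabulate⁺ {n = k} (λ _ → 0≤w) ,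
    trans (expect-equally w g (λ _ → 1#)) (trans (*-congˡ (sum-1 k)) wk≈1)

  module Mixture {N m N′ m′} (𝒯 : RandomisedPDT N m) (extract : PDT N m → Dist (PDT N′ m′))
                 (extract-isProbability : ∀ t → IsProbability (extract t)) where
    open RandomisedPDT 𝒯

    -- Entries carry a proof of non-negativity because HasSum-concatenate needs a summand that is
    -- non-negative everywhere.
    Entry : Set _
    Entry = Σ Carrier (0# ≤_) × PDT N′ m′

    attach : ∀ {D : Dist (PDT N′ m′)} → NonNegativeWeights D → List Entry
    attach []                          = []
    attach {D = (p , r) ∷ _} (0≤p ∷ D≥0) = ((p , 0≤p) , r) ∷ attach D≥0

    mixed : ∀ t → Dist (PDT N′ m′)
    mixed t = scale (prob t) (extract (tree t))

    mixed-nonNegative : ∀ t → NonNegativeWeights (mixed t)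
    mixed-nonNegative t = scale-nonNegative (0≤prob t) (proj₁ (extract-isProbability (tree t)))

    -- Its weight is zero, so any label would do.
    separator : Entry
    separator = (0# , ≤-refl) , leaf (replicate m′ false)

    entries : ℕ → Entry
    entries = concatenate separator separator [] (λ t → attach (mixed-nonNegative t))

    contribution : (PDT N′ m′ → Carrier) → Entry → Carrier
    contribution H ((p , _) , r) = p * H r

    listSum-attach : ∀ {D} (D≥0 : NonNegativeWeights D) H → listSum (contribution H) (attach D≥0) ≈ expect D H
    listSum-attach []          H = refl
    listSum-attach (0≤p ∷ D≥0) H = +-congˡ (listSum-attach D≥0 H)

    HasSum-entries : ∀ H → (∀ r → 0# ≤ H r) → ∀ {s} →
      HasSum (λ t → prob t * expect (extract (tree t)) H) s → HasSum (contribution H ∘ entries) s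
    HasSum-entries H 0≤H sums = HasSum-concatenate (contribution H) (λ ((p , 0≤p) , r) → 0≤x*y 0≤p (0≤H r))
      separator (zeroˡ _) (λ t → attach (mixed-nonNegative t))
      (HasSum-cong (λ t → prob t * expect (extract (tree t)) H) (λ t → listSum (contribution H) (attach (mixed-nonNegative t)))
        (λ t → sym (trans (listSum-attach (mixed-nonNegative t) H) (expect-scale (prob t) (extract (tree t)) H))) sums)

    mixture : RandomisedPDT N′ m′
    mixture = record
      { tree   = proj₂ ∘ entries
      ; prob   = proj₁ ∘ proj₁ ∘ entries
      ; 0≤prob = proj₂ ∘ proj₁ ∘ entries
      ; total  = HasSum-cong (contribution (λ _ → 1#) ∘ entries) (proj₁ ∘ proj₁ ∘ entries)
          (λ t → *-identityʳ (proj₁ (proj₁ (entries t))))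
          (HasSum-entries (λ _ → 1#) (λ _ → <⇒≤ 0<1)
            (HasSum-cong prob (λ t → prob t * expect (extract (tree t)) (λ _ → 1#)) expect-extract-1 total))
      }
      where
      expect-extract-1 : ∀ t → prob t ≈ prob t * expect (extract (tree t)) (λ _ → 1#)
      expect-extract-1 t = sym (trans (*-congˡ (proj₂ (extract-isProbability (tree t)))) (*-identityʳ (prob t)))

    -- Serves the error with `κ = 1` and the cost with `κ` equal to half of `k` times `lam`. The
    -- inequality is needed for each deterministic tree only; `comparison` carries it over to the
    -- series and provides the sum.
    mixture-sum : ∀ {κ} → 0# < κ → ∀ (H : PDT N′ m′ → Carrier) → (∀ r → 0# ≤ H r) → ∀ (G : PDT N m → Carrier) → (∀ t → 0# ≤ G t) →
      (∀ t → κ * expect (extract t) H ≤ G t) → ∀ {s} → HasSum (λ t → prob t * G (tree t)) s →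
      ∃[ s′ ] HasSum (contribution H ∘ entries) s′ × κ * s′ ≤ s
    mixture-sum {κ} 0<κ H 0≤H G 0≤G H≤G sums = Product.map₂ (Product.map₁ (HasSum-entries H 0≤H))
      (comparison 0<κ {λ t → prob t * expect (extract (tree t)) H} {λ t → prob t * G (tree t)}
        (λ t → 0≤x*y (0≤prob t) (0≤expect (proj₁ (extract-isProbability (tree t))) 0≤H))
        (λ t → 0≤x*y (0≤prob t) (0≤G (tree t)))
        (λ t → ≤-trans (≤-reflexive (x*[y*z]≈y*[x*z] κ (prob t) _)) (*-monoʳ-≤ (0≤prob t) (H≤G (tree t)))) sums)

  0<fromℕ : ∀ k → 1 ℕ.≤ k → 0# < fromℕ k
  0<fromℕ (suc k) _ = <-≤-trans 0<1 (x≤x+y (0≤fromℕ k))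

  0≤𝔼 : ∀ {N} {ν : Weight N} → (∀ x → 0# ≤ ν x) → ∀ {F} → (∀ x → 0# ≤ F x) → 0# ≤ 𝔼 ν F
  0≤𝔼 {zero}  0≤ν 0≤F = 0≤x*y (0≤ν []) (0≤F [])
  0≤𝔼 {suc N} 0≤ν 0≤F = 0≤x+y (0≤𝔼 {N} (0≤ν ∘ (false ∷_)) (0≤F ∘ (false ∷_))) (0≤𝔼 {N} (0≤ν ∘ (true ∷_)) (0≤F ∘ (true ∷_)))

  0≤product : ∀ {k} (F : Fin k → Carrier) → (∀ j → 0# ≤ F j) → 0# ≤ product F
  0≤product {zero}  F 0≤F = <⇒≤ 0<1
  0≤product {suc k} F 0≤F = 0≤x*y (0≤F zero) (0≤product (F ∘ suc) (0≤F ∘ suc))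

  module _ {n k : ℕ} (1≤k : 1 ℕ.≤ k) (f : Input n → Bool) {lam : Carrier} (0<lam : 0# < lam) (μ : Weight n)
           (0≤μ : ∀ x → 0# ≤ μ x) (p : Fin n → Carrier) (p-bounds : ∀ i → 0# ≤ p i × p i ≤ 1#)
           (μ≈ : ∀ x → μ x ≈ product {n} (λ i → bernoulli (p i) (lookup x i))) (bounded : IsBounded lam μ) where

    private
      -- The weight of a flagged symbol with a given bit: the largest value for which `IsBounded`
      -- alone makes every bias admissible. The factor `½` here is the constant of the theorem.
      h : Carrier
      h = lam * ½

      0<h : 0# < h
      0<h = 0<x*y 0<lam 0<½

    open Flagged h (<⇒≤ 0<h)

    admissible : VecAll.All Admissible (tabulate p)
    admissible = VecAll.tabulate⁺ λ i → ≤-resp-≈ refl (bias μ p μ≈ p-bounds i) (proj₁ (bounded i)) ,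
                                        ≤-resp-≈ (bias μ p μ≈ p-bounds i) refl (proj₂ (bounded i))

    open Extraction h (<⇒≤ 0<h) (tabulate p) admissible k

    private
      w : Carrier
      w = proj₁ (reciprocal (0<fromℕ k 1≤k))
      0<w : 0# < w
      0<w = proj₁ (proj₂ (reciprocal (0<fromℕ k 1≤k)))
      wk≈1 : w * fromℕ k ≈ 1#
      wk≈1 = proj₂ (proj₂ (reciprocal (0<fromℕ k 1≤k)))

    block-choice : Dist (Fin k)
    block-choice = equally w id

    block-choice-isProbability : IsProbability block-choice
    block-choice-isProbability = equally-isProbability {k = k} (<⇒≤ 0<w) wk≈1 id

    extract : PDT N k → Dist (PDT n 1)
    extract t = block-choice >>= λ i → symbols qs >>= λ σ → simulation i σ t

    extract-isProbability : ∀ t → IsProbability (extract t)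
    extract-isProbability t = >>=-isProbability block-choice-isProbability λ i →
      >>=-isProbability symbols-prob λ σ → Simulation.simulate-isProbability ℝ {k} {n} i (flags σ) (bits σ) [] t

    expect-extract : ∀ t H → expect (extract t) H ≈
                     w * sum {k} (λ i → expect (symbols qs) (λ σ → expect (simulation i σ t) H))
    expect-extract t H = trans (expect->>= block-choice (λ i → symbols qs >>= λ σ → simulation i σ t) H)
      (trans (expect-cong block-choice (λ i → expect->>= (symbols qs) (λ σ → simulation i σ t) H))
        (expect-equally w {k} id (λ i → expect (symbols qs) (λ σ → expect (simulation i σ t) H))))

    cost : PDT n 1 → Carrier
    cost r = 𝔼 μ (λ x → queries r x · 1#)

    extract-cost : ∀ t → (½ * (fromℕ k * lam)) * expect (extract t) cost ≤ 𝔼 (powerWeight k μ) (λ z → queries t z · 1#)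
    extract-cost t = begin
      (½ * (fromℕ k * lam)) * expect (extract t) cost
        ≈⟨ *-cong regroup (expect-cong (extract t) (λ r → 𝔼-product μ p μ≈ _)) ⟩
      (h * fromℕ k) * expect (extract t) (λ r → expect inputs (λ x → fromℕ (queries r x)))
        ≈⟨ *-congˡ (expect-extract t (λ r → expect inputs (λ x → fromℕ (queries r x)))) ⟩
      (h * fromℕ k) * (w * sum {k} (simulationCost t))
        ≈⟨ *-assoc _ _ _ ⟩
      h * (fromℕ k * (w * sum {k} (simulationCost t)))
        -- `w` is the reciprocal of `k`, so the average over the planted block cancels the factor
        -- `k`.
        ≈⟨ *-congˡ (trans (sym (*-assoc _ _ _)) (trans (*-congʳ (trans (*-comm _ _) wk≈1)) (*-identityˡ _))) ⟩
      h * sum {k} (simulationCost t)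
        ≲⟨ total-simulationCost t ⟩
      expect (independent coin qs) (λ z → fromℕ (queries t z))
        ≈⟨ 𝔼-powerWeight μ p μ≈ k _ ⟨
      𝔼 (powerWeight k μ) (λ z → queries t z · 1#)
        ∎
      where
      open ≤-Reasoning
      regroup : ½ * (fromℕ k * lam) ≈ h * fromℕ k
      regroup = trans (*-comm ½ _) (trans (*-congʳ (*-comm _ _)) (trans (*-assoc _ _ _)
        (trans (*-congˡ (*-comm _ _)) (sym (*-assoc _ _ _)))))

    extract-error : ∀ t → 1# * expect (extract t) (λ r → Pr μ (errs (single f) r)) ≤ Pr (powerWeight k μ) (errs (power k f) t)
    extract-error t = begin
      1# * expect (extract t) (λ r → Pr μ (errs (single f) r))
        ≈⟨ trans (*-identityˡ _) (expect-cong (extract t) (λ r → 𝔼-product μ p μ≈ _)) ⟩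
      expect (extract t) (λ r → expect inputs (λ x → indicator (errs (single f) r x)))
        ≈⟨ expect-extract t (λ r → expect inputs (λ x → indicator (errs (single f) r x))) ⟩
      w * sum {k} (λ i → expect (symbols qs) (λ σ → expect (simulation i σ t) (λ r → expect inputs (λ x → indicator (errs (single f) r x)))))
        ≲⟨ *-monoʳ-≤ (<⇒≤ 0<w) (sum-mono {k} _ (λ _ → e) (simulationError t f)) ⟩
      w * sum {k} (λ _ → e)
        ≈⟨ expect-equally w {k} id (λ _ → e) ⟨
      expect block-choice (λ _ → e)
        ≈⟨ expect-const e block-choice-isProbability ⟩
      e
        ≈⟨ 𝔼-powerWeight μ p μ≈ k _ ⟨
      Pr (powerWeight k μ) (errs (power k f) t)
        ∎
      where
      open ≤-Reasoning
      e = expect (independent coin qs) (λ z → indicator (errs (power k f) t z))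

    0≤powerWeight : ∀ z → 0# ≤ powerWeight k μ z
    0≤powerWeight z = 0≤product {k} (λ j → μ (lookup (blocks k z) j)) (λ j → 0≤μ (lookup (blocks k z) j))

    module Extracted (𝒯 : RandomisedPDT N k) = Mixture 𝒯 extract extract-isProbability

    extracted-tree : ∀ {ε q} (𝒯 : RandomisedPDT N k) →
      ErrorAtMost ε (power k f) 𝒯 (powerWeight k μ) → HasCost 𝒯 (powerWeight k μ) q →
      ∃[ 𝒯′ ] ErrorAtMost ε (single f) 𝒯′ μ × ∃[ q′ ] HasCost 𝒯′ μ q′ × (½ * (fromℕ k * lam)) * q′ ≤ q
    extracted-tree {ε} {q} 𝒯 (e , error , e≤ε) hasCost =
      Extracted.mixture 𝒯 , Product.map₂ (Product.map₂ e′≤ε) mixture-error , mixture-cost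
      where
      e′≤ε : ∀ {e′} → 1# * e′ ≤ e → e′ ≤ ε
      e′≤ε e′≤e = ≤-trans (≤-trans (≤-reflexive (sym (*-identityˡ _))) e′≤e) e≤ε
      mixture-error : ∃[ e′ ] HasError (single f) (Extracted.mixture 𝒯) μ e′ × 1# * e′ ≤ e
      mixture-error = Extracted.mixture-sum 𝒯 0<1 (λ r → Pr μ (errs (single f) r))
        (λ r → 0≤𝔼 {n} 0≤μ (λ x → 0≤indicator (errs (single f) r x)))
        (λ t → Pr (powerWeight k μ) (errs (power k f) t))
        (λ t → 0≤𝔼 {N} 0≤powerWeight (λ z → 0≤indicator (errs (power k f) t z))) extract-error error
      mixture-cost : ∃[ q′ ] HasCost (Extracted.mixture 𝒯) μ q′ × (½ * (fromℕ k * lam)) * q′ ≤ q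
      mixture-cost = Extracted.mixture-sum 𝒯 (0<x*y 0<½ (0<x*y (0<fromℕ k 1≤k) 0<lam)) cost
        (λ r → 0≤𝔼 {n} 0≤μ (λ x → 0≤fromℕ (queries r x)))
        (λ t → 𝔼 (powerWeight k μ) (λ z → queries t z · 1#))
        (λ t → 0≤𝔼 {N} 0≤powerWeight (λ z → 0≤fromℕ (queries t z))) extract-cost hasCost

theorem13 : ∀ {a ℓ₁ ℓ₂} (ℝ : Reals a ℓ₁ ℓ₂) →
    let open Reals ℝ
        open Average ℝ
    in
    ∃[ c ] (0# < c) ×
      (∀ (n k : ℕ) → 1 ℕ.≤ n → 1 ℕ.≤ k →
       ∀ (f : Input n → Bool) →
       ∀ (lam : Carrier) → 0# < lam → lam ≤ 1# →
       ∀ (μ : Weight n) → IsDistribution μ → IsProduct μ → IsBounded lam μ →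
       ∀ (ε : Carrier) → 0# ≤ ε →
       ∀ (dₖ d₁ : Carrier) →
       HasComplexity ε (power k f) (powerWeight k μ) dₖ →
       HasComplexity ε (single f) μ d₁ →
       c * ((k · 1#) * lam) * d₁ ≤ dₖ)
theorem13 ℝ = ½ , 0<½ ,
  λ n k _ 1≤k f lam 0<lam _ μ (0≤μ , _) (p , p-bounds , μ≈) bounded ε _ dₖ d₁ Dₖ D₁ →
    let open HasComplexity
        -- An optimal tree for the `k` copies yields a competitor in the minimum for `f`, whose cost
        -- is therefore at least `d₁`.
        𝒯 , error , hasCost = attained Dₖ
        𝒯′ , error′ , q′ , hasCost′ , q′≤dₖ =
          extracted-tree 1≤k f 0<lam μ 0≤μ p p-bounds μ≈ bounded 𝒯 error hasCost
    in ≤-trans (*-monoʳ-≤ (<⇒≤ (0<x*y 0<½ (0<x*y (0<fromℕ k 1≤k) 0<lam))) (lowerBound D₁ 𝒯′ q′ error′ hasCost′)) q′≤dₖ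
  where
  open RealProperties ℝ
  open Averaging ℝ
  open Average ℝ
  open DirectSum ℝ
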